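{- Let $G_i=(V_i,E_i)$, $i=1,2$, be two locally finite simple graphs. Then for any $x\in V_1$ and $y\in V_2$, $$\mathcal K_{G_1\times G_2,(x,y)}=\mathcal K_{G_1,x}*\mathcal K_{G_2,y}$$ as functions on $(0,\infty]$.
   Context: Graphs are undirected, without loops or multiple edges, and every vertex has finite degree; the vertices $x$ and $y$ considered have degree at least $1$. For $f:V\to\mathbb R$ put $\Delta f(x)=\sum_{y\sim x}(f(y)-f(x))$ (non-normalized Laplacian), and for $f,g:V\to\mathbb R$ put $2\Gamma(f,g)=\Delta(fg)-f\Delta g-g\Delta f$, $2\Gamma_2(f,g)=\Delta\Gamma(f,g)-\Gamma(f,\Delta g)-\Gamma(\Delta f,g)$, $\Gamma(f)=\Gamma(f,f)$, $\Gamma_2(f)=\Gamma_2(f,f)$. For $\mathcal N\in(0,\infty]$ (convention $1/\infty=0$), $\mathcal K_{G,x}(\mathcal N)$ is the largest $K\in\mathbb R$ such that $\Gamma_2(f)(x)\ge\frac1{\mathcal N}(\Delta f(x))^2+K\,\Gamma(f)(x)$ for all $f:V\to\mathbb R$ (Bakry-Émery curvature function). Cartesian product: $G_1\times G_2$ has vertex set $V_1\times V_2$, and $(x_1,y_1),(x_2,y_2)$ are adjacent iff either $x_1=x_2$ and $\{y_1,y_2\}\in E_2$, or $\{x_1,x_2\}\in E_1$ and $y_1=y_2$. $*$-product: let $\mathcal{FK}$ be the set of continuous, monotone non-decreasing functions $f:(0,\infty]\to\mathbb R$ with $\lim_{\mathcal N\to0}f(\mathcal N)=-\infty$ (curvature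 functions $\mathcal K_{G,x}$ belong to $\mathcal{FK}$). For $f_1,f_2\in\mathcal{FK}$ and $\mathcal N\in(0,\infty)$, define $f_1*f_2(\mathcal N):=f_1(\mathcal N_1)=f_2(\mathcal N_2)$, where $\mathcal N_1,\mathcal N_2>0$ are chosen with $\mathcal N_1+\mathcal N_2=\mathcal N$ and $f_1(\mathcal N_1)=f_2(\mathcal N_2)$ (such a pair exists and the value does not depend on the choice), and $f_1*f_2(\infty):=\lim_{\mathcal N\to\infty}f_1*f_2(\mathcal N)$ (the limit exists). -}

module Defs where

open import Algebra.Bundles using (CommutativeRing)
open import Algebra.Core using (Op₁)
open import Axiom.ExcludedMiddle using (ExcludedMiddle)
open import Data.List.Base using (List; _++_; map; foldr; length)
open import Data.List.Membership.Propositional using (_∈_)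
open import Data.List.Membership.Propositional.Properties
  using (∈-map⁺; ∈-map⁻; ∈-++⁺ˡ; ∈-++⁺ʳ; ∈-++⁻)
open import Data.List.Relation.Unary.Unique.Propositional using (Unique)
open import Data.List.Relation.Unary.Unique.Propositional.Properties
  using (map⁺; ++⁺)
open import Data.Nat.Base using (ℕ)
open import Data.Product.Base using (∃; Σ-syntax; ∃-syntax; _×_; _,_)
open import Data.Product.Properties using (,-injectiveˡ; ,-injectiveʳ)
open import Data.Sum.Base using (_⊎_; inj₁; inj₂)
open import Function.Bundles using (_⇔_; mk⇔; Equivalence)
open import Level using (Level; suc)
open import Relation.Binary.Core using (Rel)
open import Relation.Binary.Structures using (IsTotalOrder)
open import Relation.Binary.PropositionalEquality.Core using (_≡_; refl)
open import Relation.Nullary using (¬_; Dec; yes; no; contradiction)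
import Relation.Binary.Construct.NonStrictToStrict as Strict

------------------------------------------------------------------------
-- The real numbers

-- The library has no real numbers.  They are given axiomatically, as a
-- Dedekind-complete ordered field; classically this determines ℝ up to
-- unique isomorphism.
record RealField (ℓ : Level) : Set (suc ℓ) where
  field
    commutativeRing : CommutativeRing ℓ ℓ

  open CommutativeRing commutativeRing public

  infix 4 _≤_ _<_
  infix 8 _⁻¹

  field
    _≤_          : Rel Carrier ℓ
    isTotalOrder : IsTotalOrder _≈_ _≤_
    0≉1          : ¬ (0# ≈ 1#)
    +-monoˡ-≤    : ∀ {x y} z → x ≤ y → x + z ≤ y + z
    *-nonNeg     : ∀ {x y} → 0# ≤ x → 0# ≤ y → 0# ≤ x * y

    -- Total inverse; nothing is assumed about the value at zero.
    _⁻¹          : Op₁ Carrier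
    ⁻¹-inverseʳ  : ∀ x → ¬ (x ≈ 0#) → x * x ⁻¹ ≈ 1#

  _<_ : Rel Carrier ℓ
  _<_ = Strict._<_ _≈_ _≤_

  IsUpperBound : (Carrier → Set ℓ) → Carrier → Set ℓ
  IsUpperBound P b = ∀ x → P x → x ≤ b

  field
    complete : (P : Carrier → Set ℓ) → ∃ P → ∃ (IsUpperBound P) →
               ∃[ s ] (IsUpperBound P s × (∀ b → IsUpperBound P b → s ≤ b))

------------------------------------------------------------------------
-- Locally finite simple graphs

-- Edges are unordered, hence a symmetric relation.  Local finiteness is
-- witnessed by a duplicate-free list of the neighbours of each vertex.
record Graph (ℓ : Level) : Set (suc ℓ) where
  infix 4 _∼_
  field
    V          : Set ℓ
    _∼_        : Rel V ℓ
    ∼-sym      : ∀ {x y} → x ∼ y → y ∼ x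
    ∼-irrefl   : ∀ {x} → ¬ (x ∼ x)
    nbrs       : V → List V
    nbrs-uniq  : ∀ x → Unique (nbrs x)
    ∈-nbrs     : ∀ {x y} → y ∈ nbrs x ⇔ x ∼ y

  degree : V → ℕ
  degree x = length (nbrs x)

open Graph public using (V; degree)

infixr 5 _□_

_□_ : ∀ {ℓ} → Graph ℓ → Graph ℓ → Graph ℓ
_□_ {ℓ} G₁ G₂ = record
  { V         = V₁ × V₂
  ; _∼_       = Adj
  ; ∼-sym     = adj-sym
  ; ∼-irrefl  = λ { (inj₁ (_ , e)) → G₂.∼-irrefl e
                  ; (inj₂ (e , _)) → G₁.∼-irrefl e }
  ; nbrs      = nb
  ; nbrs-uniq = λ (x , y) →
      ++⁺ (map⁺ ,-injectiveʳ (G₂.nbrs-uniq y))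
          (map⁺ ,-injectiveˡ (G₁.nbrs-uniq x))
          (λ (p , q) → disjoint p q)
  ; ∈-nbrs    = mk⇔ (nb⇒adj _) adj⇒nb
  }
  where
  module G₁ = Graph G₁
  module G₂ = Graph G₂
  V₁ = G₁.V
  V₂ = G₂.V

  Adj : Rel (V₁ × V₂) ℓ
  Adj (x₁ , y₁) (x₂ , y₂) = (x₁ ≡ x₂ × y₁ G₂.∼ y₂) ⊎ (x₁ G₁.∼ x₂ × y₁ ≡ y₂)

  adj-sym : ∀ {p q} → Adj p q → Adj q p
  adj-sym (inj₁ (refl , e)) = inj₁ (refl , G₂.∼-sym e)
  adj-sym (inj₂ (e , refl)) = inj₂ (G₁.∼-sym e , refl)

  nb : V₁ × V₂ → List (V₁ × V₂)
  nb (x , y) = map (x ,_) (G₂.nbrs y) ++ map (_, y) (G₁.nbrs x)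

  disjoint : ∀ {x y q} → q ∈ map (x ,_) (G₂.nbrs y) →
             ¬ (q ∈ map (_, y) (G₁.nbrs x))
  disjoint p q with ∈-map⁻ _ p | ∈-map⁻ _ q
  ... | _ , y∈ , refl | _ , _ , refl =
    G₂.∼-irrefl (Equivalence.to G₂.∈-nbrs y∈)

  nb⇒adj : ∀ p {q} → q ∈ nb p → Adj p q
  nb⇒adj (x , y) q∈ with ∈-++⁻ (map (x ,_) (G₂.nbrs y)) q∈
  ... | inj₁ r with ∈-map⁻ _ r
  ...   | _ , y∈ , refl = inj₁ (refl , Equivalence.to G₂.∈-nbrs y∈)
  nb⇒adj (x , y) q∈ | inj₂ r with ∈-map⁻ _ r
  ...   | _ , x∈ , refl = inj₂ (Equivalence.to G₁.∈-nbrs x∈ , refl)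

  adj⇒nb : ∀ {p q} → Adj p q → q ∈ nb p
  adj⇒nb (inj₁ (refl , e)) = ∈-++⁺ˡ (∈-map⁺ _ (Equivalence.from G₂.∈-nbrs e))
  adj⇒nb {x , y} (inj₂ (e , refl)) =
    ∈-++⁺ʳ (map (x ,_) (G₂.nbrs y)) (∈-map⁺ _ (Equivalence.from G₁.∈-nbrs e))

------------------------------------------------------------------------
-- Bakry-Émery curvature functions and their *-product

module Curvature {ℓ : Level} (em : ExcludedMiddle ℓ) (ℝ : RealField ℓ) where

  open RealField ℝ

  -- "The" real number satisfying P.  It is the junk value 0# if there is
  -- none, and is used below only for properties that determine a number.
  the : (Carrier → Set ℓ) → Carrier
  the P with em {∃ P}
  ... | yes (a , _) = a
  ... | no  _       = 0#

  the-spec : ∀ P → ∃ P → P (the P)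
  the-spec P ex with em {∃ P}
  ... | yes (_ , p) = p
  ... | no  ¬ex     = contradiction ex ¬ex

  data ]0,∞] : Set ℓ where
    fin : (N : Carrier) → 0# < N → ]0,∞]
    ∞   : ]0,∞]

  1/_ : ]0,∞] → Carrier
  1/ fin N _ = N ⁻¹
  1/ ∞       = 0#

  module _ (G : Graph ℓ) where
    open Graph G using (nbrs)

    Fun : Set ℓ
    Fun = V G → Carrier

    Δ : Fun → Fun
    Δ f x = foldr _+_ 0# (map (λ y → f y - f x) (nbrs x))

    ½ : Carrier
    ½ = (1# + 1#) ⁻¹

    Γ : Fun → Fun → Fun
    Γ f g x = ½ * (Δ (λ z → f z * g z) x - f x * Δ g x - g x * Δ f x)

    Γ₂ : Fun → Fun → Fun
    Γ₂ f g x = ½ * (Δ (Γ f g) x - Γ f (Δ g) x - Γ (Δ f) g x)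

    -- The curvature-dimension inequality at x.
    CD : V G → ]0,∞] → Carrier → Set ℓ
    CD x N K = ∀ (f : Fun) →
      (1/ N) * (Δ f x * Δ f x) + K * Γ f f x ≤ Γ₂ f f x

    𝒦 : V G → ]0,∞] → Carrier
    𝒦 x N = the (λ K → CD x N K × (∀ K′ → CD x N K′ → K′ ≤ K))

  -- L is the limit of h(N) as the finite parameter N tends to ∞.
  LimitAt∞ : (∀ N → 0# < N → Carrier) → Carrier → Set ℓ
  LimitAt∞ h L = ∀ ε → 0# < ε → ∃[ M ] (∀ N (N>0 : 0# < N) → M ≤ N →
    (L - ε < h N N>0) × (h N N>0 < L + ε))

  -- v is the common value of f₁ and f₂ at some splitting N = N₁ + N₂.
  -- For non-decreasing f₁ and f₂ there is at most one such v: if N₁ grows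
  -- then N₂ shrinks.
  BalancedValue : (f₁ f₂ : ]0,∞] → Carrier) → Carrier → Carrier → Set ℓ
  BalancedValue f₁ f₂ N v =
    Σ[ N₁ ∈ Carrier ] Σ[ N₂ ∈ Carrier ]
    Σ[ N₁>0 ∈ 0# < N₁ ] Σ[ N₂>0 ∈ 0# < N₂ ]
      (N₁ + N₂ ≈ N) × (v ≈ f₁ (fin N₁ N₁>0)) × (v ≈ f₂ (fin N₂ N₂>0))

  infixl 7 _⋆_

  -- Defined for all functions; it is meaningful when f₁ and f₂ are
  -- continuous, non-decreasing and tend to -∞ at 0, as then the balanced
  -- value and the limit exist.
  _⋆_ : (f₁ f₂ : ]0,∞] → Carrier) → ]0,∞] → Carrier
  (f₁ ⋆ f₂) (fin N _) = the (BalancedValue f₁ f₂ N)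
  (f₁ ⋆ f₂) ∞         =
    the (LimitAt∞ (λ N _ → the (BalancedValue f₁ f₂ N)))

module Submission where

-- Write s = 1/𝒩 and consider, at a vertex, the pairs (s, K) for which the
-- curvature-dimension inequality holds.  Since (Δf)² ≤ C Γ(f), the largest K
-- is a Lipschitz non-increasing function κ of s on [0,∞[; it tends to -∞
-- because Δf ≠ 0 for some f.
--
-- On a product, Δ and Γ are the sums of those of the two sections F(·,y) and
-- F(x,·), and Γ₂ exceeds the sum by half the sum of the squares of the mixed
-- differences of F, which vanish when F is a sum f ⊕ g.  Hence the inequality on
-- G₁ □ G₂ is the one for pairs (f, g) with the Δ, Γ and Γ₂ of f and g added.  If
-- κ₁(1/N₁) = κ₂(1/N₂) = K, then (a + b)²/(N₁ + N₂) ≤ a²/N₁ + b²/N₂ gives the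
-- inequality for the product with the same K, and rescaling f and g to the
-- equality case a = N₁, b = N₂ shows that K is largest.  Such a splitting N₁ + N₂
-- of 𝒩 exists by the intermediate value theorem, and the Lipschitz bound at s = 0
-- gives 𝒩 = ∞.

open import Defs
open import Level using (Level) renaming (suc to lsuc)
open import Axiom.ExcludedMiddle using (ExcludedMiddle)
open import Algebra.Solver.Ring.AlmostCommutativeRing
  using (fromCommutativeRing; _-Raw-AlmostCommutative⟶_)
import Algebra.Properties.Ring as RingProperties
import Algebra.Properties.Semiring.Mult.TCOptimised as Multiples
import Algebra.Solver.Ring as RingSolver
open import Data.Integer.Base as ℤ using (ℤ; +_; -[1+_])
import Data.Integer.Properties as ℤ
open import Data.List.Base using (List; []; _∷_; _++_; map; foldr; length)
open import Data.List.Membership.Propositional using (_∈_)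
open import Data.List.Relation.Unary.Any using (here; there)
open import Data.Maybe.Base using (Maybe; just; nothing)
open import Data.Nat.Base as ℕ using (zero; suc; z≤n; s≤s)
open import Data.Product.Base using (Σ-syntax; ∃; ∃-syntax; _×_; _,_; proj₁; proj₂)
open import Data.Sum.Base using (_⊎_; inj₁; inj₂; [_,_]′)
open import Function.Bundles using (Equivalence)
open import Relation.Binary.Bundles using (Poset)
open import Relation.Binary.Structures using (IsTotalOrder)
open import Relation.Binary.PropositionalEquality.Core as ≡ using (_≡_)
import Relation.Binary.Reasoning.PartialOrder as ≤-Reasoning
import Relation.Binary.Reasoning.Setoid as ≈-Reasoning
open import Relation.Nullary using (¬_; yes; no; contradiction)

-- The embedding of the integers in the field, and the ring solver.

module IntegerCoefficients {ℓ : Level} (ℝ : RealField ℓ) where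
  open RealField ℝ
  open RingProperties ring using (-0#≈0#; -‿distribˡ-*; -‿involutive; -‿+-comm)
  open Multiples semiring renaming (_×_ to _·_)
  open ≈-Reasoning setoid

  -- Coefficients are compared in ℤ, where equality is decided by computation; this lets the solver
  -- cancel numerical coefficients over an abstract field.
  embed : ℤ → Carrier
  embed (+ n)    = n · 1#
  embed -[1+ n ] = - (suc n · 1#)

  private
    embed-neg : ∀ i → embed (ℤ.- i) ≈ - embed i
    embed-neg (+ zero)   = sym -0#≈0#
    embed-neg (+ suc n)  = refl
    embed-neg (-[1+ n ]) = sym (-‿involutive _)

    cancel-1 : ∀ a b → a - b ≈ (1# + a) - (1# + b)
    cancel-1 a b = begin
      a - b                    ≈⟨ +-identityˡ _ ⟨
      0# + (a - b)             ≈⟨ +-congʳ (-‿inverseʳ 1#) ⟨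
      (1# - 1#) + (a - b)      ≈⟨ +-assoc _ _ _ ⟩
      1# + (- 1# + (a - b))    ≈⟨ +-congˡ (sym (+-assoc _ _ _)) ⟩
      1# + (- 1# + a - b)      ≈⟨ +-congˡ (+-congʳ (+-comm _ _)) ⟩
      1# + (a - 1# - b)        ≈⟨ +-congˡ (+-assoc _ _ _) ⟩
      1# + (a + (- 1# - b))    ≈⟨ +-assoc _ _ _ ⟨
      (1# + a) + (- 1# - b)    ≈⟨ +-congˡ (-‿+-comm 1# b) ⟩
      (1# + a) - (1# + b)      ∎

    embed-⊖ : ∀ m n → embed (m ℤ.⊖ n) ≈ m · 1# - n · 1#
    embed-⊖ m       zero    = sym (trans (+-congˡ -0#≈0#) (+-identityʳ _))
    embed-⊖ zero    (suc n) = sym (+-identityˡ _)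
    embed-⊖ (suc m) (suc n) = begin
      embed (suc m ℤ.⊖ suc n)            ≡⟨ ≡.cong embed (ℤ.[1+m]⊖[1+n]≡m⊖n m n) ⟩
      embed (m ℤ.⊖ n)                    ≈⟨ embed-⊖ m n ⟩
      m · 1# - n · 1#                    ≈⟨ cancel-1 _ _ ⟩
      (1# + m · 1#) - (1# + n · 1#)      ≈⟨ +-cong (1+× m 1#) (-‿cong (1+× n 1#)) ⟨
      suc m · 1# - suc n · 1#            ∎

    embed-+ : ∀ i j → embed (i ℤ.+ j) ≈ embed i + embed j
    embed-+ (+ m)    (+ n)    = ×-homo-+ 1# m n
    embed-+ (+ m)    -[1+ n ] = embed-⊖ m (suc n)
    embed-+ -[1+ m ] (+ n)    = trans (embed-⊖ n (suc m)) (+-comm _ _)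
    embed-+ -[1+ m ] -[1+ n ] = begin
      - (suc (suc (m ℕ.+ n)) · 1#)       ≈⟨ -‿cong (1+× (suc m ℕ.+ n) 1#) ⟩
      - (1# + (suc m ℕ.+ n) · 1#)        ≈⟨ -‿cong (+-congˡ (×-homo-+ 1# (suc m) n)) ⟩
      - (1# + (suc m · 1# + n · 1#))     ≈⟨ -‿cong (sym (+-assoc _ _ _)) ⟩
      - (1# + suc m · 1# + n · 1#)       ≈⟨ -‿cong (+-congʳ (+-comm _ _)) ⟩
      - (suc m · 1# + 1# + n · 1#)       ≈⟨ -‿cong (+-assoc _ _ _) ⟩
      - (suc m · 1# + (1# + n · 1#))     ≈⟨ -‿cong (+-congˡ (1+× n 1#)) ⟨
      - (suc m · 1# + suc n · 1#)        ≈⟨ -‿+-comm _ _ ⟨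
      - (suc m · 1#) - suc n · 1#        ∎

    embed-+* : ∀ m j → embed (+ m ℤ.* j) ≈ m · 1# * embed j
    embed-+* m (+ n) = begin
      embed (+ m ℤ.* + n)   ≡⟨ ≡.cong embed (ℤ.pos-* m n) ⟨
      (m ℕ.* n) · 1#        ≈⟨ ×1-homo-* m n ⟩
      m · 1# * n · 1#       ∎
    embed-+* m -[1+ n ] = begin
      embed (+ m ℤ.* -[1+ n ])        ≡⟨ ≡.cong embed (ℤ.neg-distribʳ-* (+ m) (+ suc n)) ⟨
      embed (ℤ.- (+ m ℤ.* + suc n))   ≈⟨ embed-neg (+ m ℤ.* + suc n) ⟩
      - embed (+ m ℤ.* + suc n)       ≈⟨ -‿cong (embed-+* m (+ suc n)) ⟩
      - (m · 1# * suc n · 1#)         ≈⟨ RingProperties.-‿distribʳ-* ring _ _ ⟩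
      m · 1# * - (suc n · 1#)         ∎

    embed-* : ∀ i j → embed (i ℤ.* j) ≈ embed i * embed j
    embed-* (+ m)    j = embed-+* m j
    embed-* -[1+ m ] j = begin
      embed (-[1+ m ] ℤ.* j)          ≡⟨ ≡.cong embed (ℤ.neg-distribˡ-* (+ suc m) j) ⟨
      embed (ℤ.- (+ suc m ℤ.* j))     ≈⟨ embed-neg (+ suc m ℤ.* j) ⟩
      - embed (+ suc m ℤ.* j)         ≈⟨ -‿cong (embed-+* (suc m) j) ⟩
      - (suc m · 1# * embed j)        ≈⟨ -‿distribˡ-* _ _ ⟩
      - (suc m · 1#) * embed j        ∎

    morphism : ℤ.+-*-rawRing -Raw-AlmostCommutative⟶ fromCommutativeRing commutativeRing
    morphism = record
      { ⟦_⟧    = embed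
      ; +-homo = embed-+
      ; *-homo = embed-*
      ; -‿homo = embed-neg
      ; 0-homo = refl
      ; 1-homo = refl
      }

    embed-≟ : ∀ i j → Maybe (embed i ≈ embed j)
    embed-≟ i j with i ℤ.≟ j
    ... | yes ≡.refl = just refl
    ... | no _       = nothing

  open RingSolver ℤ.+-*-rawRing (fromCommutativeRing commutativeRing) morphism embed-≟ public
    using (solve; _:=_; _:+_; _:*_; _:-_; :-_; con)

-- Ordered-field arithmetic and an intermediate value theorem.

module OrderedField {ℓ : Level} (em : ExcludedMiddle ℓ) (ℝ : RealField ℓ) where
  open RealField ℝ
  open IntegerCoefficients ℝ
  open IsTotalOrder isTotalOrder public
    using (total; antisym)
    renaming (refl to ≤-refl; trans to ≤-trans; reflexive to ≤-reflexive)

  poset : Poset ℓ ℓ ℓ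
  poset = record { isPartialOrder = IsTotalOrder.isPartialOrder isTotalOrder }

  open ≤-Reasoning poset

  <⇒≤ : ∀ {x y} → x < y → x ≤ y
  <⇒≤ = proj₁

  <⇒≱ : ∀ {x y} → x < y → ¬ (y ≤ x)
  <⇒≱ (x≤y , x≉y) y≤x = x≉y (antisym x≤y y≤x)

  ≰⇒> : ∀ {x y} → ¬ (x ≤ y) → y < x
  ≰⇒> {x} {y} x≰y with total x y
  ... | inj₁ x≤y = contradiction x≤y x≰y
  ... | inj₂ y≤x = y≤x , λ y≈x → x≰y (≤-reflexive (sym y≈x))

  ≮⇒≥ : ∀ {x y} → ¬ (x < y) → y ≤ x
  ≮⇒≥ {x} {y} x≮y with em {y ≤ x}
  ... | yes y≤x = y≤x
  ... | no  y≰x = contradiction (≰⇒> y≰x) x≮y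

  <-≤-trans : ∀ {x y z} → x < y → y ≤ z → x < z
  <-≤-trans {x} {y} {z} x<y y≤z = begin-strict x <⟨ x<y ⟩ y ≤⟨ y≤z ⟩ z ∎

  -- To be used with r a combination of nonnegative terms for which y - x ≈ r
  -- is a ring identity.
  ≤-by : ∀ {x y r} → 0# ≤ r → y - x ≈ r → x ≤ y
  ≤-by {x} {y} {r} 0≤r y-x≈r = begin
    x              ≈⟨ +-identityˡ x ⟨
    0# + x         ≤⟨ +-monoˡ-≤ x 0≤r ⟩
    r + x          ≈⟨ +-congʳ y-x≈r ⟨
    y - x + x      ≈⟨ solve 2 (λ x y → y :- x :+ x := y) refl x y ⟩
    y              ∎

  x≤y⇒0≤y-x : ∀ {x y} → x ≤ y → 0# ≤ y - x
  x≤y⇒0≤y-x {x} {y} x≤y = begin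
    0#       ≈⟨ -‿inverseʳ x ⟨
    x - x    ≤⟨ +-monoˡ-≤ (- x) x≤y ⟩
    y - x    ∎

  +-nonNeg : ∀ {x y} → 0# ≤ x → 0# ≤ y → 0# ≤ x + y
  +-nonNeg {x} {y} 0≤x 0≤y = begin
    0#      ≤⟨ 0≤y ⟩
    y       ≈⟨ +-identityˡ y ⟨
    0# + y  ≤⟨ +-monoˡ-≤ y 0≤x ⟩
    x + y   ∎

  +-mono-≤ : ∀ {x y u v} → x ≤ y → u ≤ v → x + u ≤ y + v
  +-mono-≤ {x} {y} {u} {v} x≤y u≤v =
    ≤-by (+-nonNeg (x≤y⇒0≤y-x x≤y) (x≤y⇒0≤y-x u≤v))
      (solve 4 (λ x y u v → (y :+ v) :- (x :+ u) := (y :- x) :+ (v :- u)) refl x y u v)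

  *-monoˡ-≤ : ∀ {x y z} → 0# ≤ z → x ≤ y → z * x ≤ z * y
  *-monoˡ-≤ {x} {y} {z} 0≤z x≤y = ≤-by (*-nonNeg 0≤z (x≤y⇒0≤y-x x≤y))
    (solve 3 (λ x y z → z :* y :- z :* x := z :* (y :- x)) refl x y z)

  *-monoʳ-≤ : ∀ {x y z} → 0# ≤ z → x ≤ y → x * z ≤ y * z
  *-monoʳ-≤ {x} {y} {z} 0≤z x≤y = ≤-by (*-nonNeg 0≤z (x≤y⇒0≤y-x x≤y))
    (solve 3 (λ x y z → y :* z :- x :* z := z :* (y :- x)) refl x y z)

  0≤x² : ∀ x → 0# ≤ x * x
  0≤x² x with total 0# x
  ... | inj₁ 0≤x = *-nonNeg 0≤x 0≤x
  ... | inj₂ x≤0 = begin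
    0#                     ≤⟨ *-nonNeg 0≤-x 0≤-x ⟩
    (0# - x) * (0# - x)    ≈⟨
          solve 1 (λ x → (con (+ 0) :- x) :* (con (+ 0) :- x) := x :* x) refl x ⟩
    x * x                  ∎
    where
    0≤-x = x≤y⇒0≤y-x x≤0

  0≤1 : 0# ≤ 1#
  0≤1 = ≤-trans (0≤x² 1#) (≤-reflexive (*-identityˡ 1#))

  0<1 : 0# < 1#
  0<1 = 0≤1 , 0≉1

  +-pos-nonNeg : ∀ {x y} → 0# < x → 0# ≤ y → 0# < x + y
  +-pos-nonNeg {x} {y} 0<x 0≤y = <-≤-trans 0<x (begin
    x       ≈⟨ +-identityʳ x ⟨
    x + 0#  ≤⟨ +-mono-≤ ≤-refl 0≤y ⟩
    x + y   ∎)

  pos⇒≉0 : ∀ {x} → 0# < x → ¬ (x ≈ 0#)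
  pos⇒≉0 (_ , 0≉x) x≈0 = 0≉x (sym x≈0)

  x*x⁻¹≈1 : ∀ {x} → 0# < x → x * x ⁻¹ ≈ 1#
  x*x⁻¹≈1 {x} 0<x = ⁻¹-inverseʳ x (pos⇒≉0 0<x)

  ⁻¹-pos : ∀ {x} → 0# < x → 0# < x ⁻¹
  ⁻¹-pos {x} 0<x = ≰⇒> λ x⁻¹≤0 → <⇒≱ 0<1 (begin
    1#         ≈⟨ x*x⁻¹≈1 0<x ⟨
    x * x ⁻¹   ≤⟨ *-monoˡ-≤ (<⇒≤ 0<x) x⁻¹≤0 ⟩
    x * 0#     ≈⟨ zeroʳ x ⟩
    0#         ∎)

  ⁻¹-cancelˡ : ∀ {x} y → ¬ (x ≈ 0#) → x ⁻¹ * (x * y) ≈ y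
  ⁻¹-cancelˡ {x} y x≉0 = begin-equality
    x ⁻¹ * (x * y)    ≈⟨ solve 3 (λ x i y → i :* (x :* y) := x :* i :* y) refl x (x ⁻¹) y ⟩
    x * x ⁻¹ * y      ≈⟨ *-congʳ (⁻¹-inverseʳ x x≉0) ⟩
    1# * y            ≈⟨ *-identityˡ y ⟩
    y                 ∎

  ⁻¹-cancelʳ : ∀ {x} y → ¬ (x ≈ 0#) → x * (x ⁻¹ * y) ≈ y
  ⁻¹-cancelʳ {x} y x≉0 = trans
    (solve 3 (λ x i y → x :* (i :* y) := i :* (x :* y)) refl x (x ⁻¹) y) (⁻¹-cancelˡ y x≉0)

  *-cancelˡ-≤ : ∀ {x y z} → 0# < z → z * x ≤ z * y → x ≤ y
  *-cancelˡ-≤ {x} {y} {z} 0<z zx≤zy = begin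
    x                ≈⟨ ⁻¹-cancelˡ x (pos⇒≉0 0<z) ⟨
    z ⁻¹ * (z * x)   ≤⟨ *-monoˡ-≤ (<⇒≤ (⁻¹-pos 0<z)) zx≤zy ⟩
    z ⁻¹ * (z * y)   ≈⟨ ⁻¹-cancelˡ y (pos⇒≉0 0<z) ⟩
    y                ∎

  *-pos : ∀ {x y} → 0# < x → 0# < y → 0# < x * y
  *-pos {x} {y} 0<x 0<y = ≰⇒> λ xy≤0 → <⇒≱ 0<y
    (*-cancelˡ-≤ 0<x (≤-trans xy≤0 (≤-reflexive (sym (zeroʳ x)))))

  0<x² : ∀ {x} → ¬ (x ≈ 0#) → 0# < x * x
  0<x² {x} x≉0 = ≰⇒> λ x²≤0 → x≉0 (begin-equality
    x                ≈⟨ ⁻¹-cancelˡ x x≉0 ⟨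
    x ⁻¹ * (x * x)   ≈⟨ *-congˡ (antisym x²≤0 (0≤x² x)) ⟩
    x ⁻¹ * 0#        ≈⟨ zeroʳ _ ⟩
    0#               ∎)

  ⁻¹-difference : ∀ {x y} → 0# < x → 0# < y → x ⁻¹ - y ⁻¹ ≈ (y - x) * (x ⁻¹ * y ⁻¹)
  ⁻¹-difference {x} {y} 0<x 0<y = begin-equality
    x ⁻¹ - y ⁻¹
      ≈⟨ +-cong (*-identityˡ _) (-‿cong (*-identityˡ _)) ⟨
    1# * x ⁻¹ - 1# * y ⁻¹
      ≈⟨ +-cong (*-congʳ (x*x⁻¹≈1 0<y)) (-‿cong (*-congʳ (x*x⁻¹≈1 0<x))) ⟨
    y * y ⁻¹ * x ⁻¹ - x * x ⁻¹ * y ⁻¹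
      ≈⟨ solve 4 (λ x y i j → y :* j :* i :- x :* i :* j := (y :- x) :* (i :* j))
           refl x y (x ⁻¹) (y ⁻¹) ⟩
    (y - x) * (x ⁻¹ * y ⁻¹) ∎

  ⁻¹-anti-≤ : ∀ {x y} → 0# < x → x ≤ y → y ⁻¹ ≤ x ⁻¹
  ⁻¹-anti-≤ 0<x x≤y = ≤-by
    (*-nonNeg (x≤y⇒0≤y-x x≤y) (*-nonNeg (<⇒≤ (⁻¹-pos 0<x)) (<⇒≤ (⁻¹-pos 0<y))))
    (⁻¹-difference 0<x 0<y)
    where 0<y = <-≤-trans 0<x x≤y

  -- Congruence of `_⁻¹` is not an axiom of `RealField`; for positive arguments it follows from
  -- antitonicity in both directions.
  ⁻¹-cong : ∀ {x y} → 0# < x → x ≈ y → x ⁻¹ ≈ y ⁻¹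
  ⁻¹-cong 0<x x≈y = antisym
    (⁻¹-anti-≤ (<-≤-trans 0<x (≤-reflexive x≈y)) (≤-reflexive (sym x≈y)))
    (⁻¹-anti-≤ 0<x (≤-reflexive x≈y))

  ⁻¹-involutive : ∀ {x} → 0# < x → x ⁻¹ ⁻¹ ≈ x
  ⁻¹-involutive {x} 0<x = begin-equality
    x ⁻¹ ⁻¹                  ≈⟨ ⁻¹-cancelˡ _ (pos⇒≉0 0<x) ⟨
    x ⁻¹ * (x * x ⁻¹ ⁻¹)     ≈⟨
          solve 3 (λ i x k → i :* (x :* k) := i :* k :* x) refl (x ⁻¹) x (x ⁻¹ ⁻¹) ⟩
    x ⁻¹ * x ⁻¹ ⁻¹ * x       ≈⟨ *-congʳ (x*x⁻¹≈1 (⁻¹-pos 0<x)) ⟩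
    1# * x                   ≈⟨ *-identityˡ x ⟩
    x                        ∎

  upperBound₂ : ∀ x y → ∃[ z ] (x ≤ z × y ≤ z)
  upperBound₂ x y with total x y
  ... | inj₁ x≤y = y , x≤y , ≤-refl
  ... | inj₂ y≤x = x , ≤-refl , y≤x

  ½ : Carrier
  ½ = (1# + 1#) ⁻¹

  0<2 : 0# < 1# + 1#
  0<2 = +-pos-nonNeg 0<1 0≤1

  ½+½≈1 : ½ + ½ ≈ 1#
  ½+½≈1 = trans (solve 1 (λ h → h :+ h := (con (+ 1) :+ con (+ 1)) :* h) refl ½)
                (x*x⁻¹≈1 0<2)

  -- The root is the supremum of the points where g is nonpositive; an upper
  -- bound on the growth of g suffices, as g may only jump downwards.
  zeroOfLipschitz : (g : Carrier → Carrier) (a b L : Carrier) → 0# ≤ L →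
    a ≤ b → (∀ s t → a ≤ s → s ≤ t → t ≤ b → g t ≤ g s + L * (t - s)) →
    g a ≤ 0# → 0# ≤ g b → ∃[ t ] (a ≤ t × t ≤ b × g t ≈ 0#)
  zeroOfLipschitz g a b L 0≤L a≤b lip ga≤0 0≤gb =
    c , a≤c , c≤b , antisym (≮⇒≥ gc≯0) (≮⇒≥ gc≮0)
    where
    -- The added 1 makes the slope positive, hence invertible, even if `L` is zero.
    M = L + 1#
    0<M : 0# < M
    0<M = <-≤-trans 0<1 (≤-by 0≤L (solve 1 (λ L → L :+ con (+ 1) :- con (+ 1) := L) refl L))
    A : Carrier → Set ℓ
    A t = a ≤ t × t ≤ b × g t ≤ 0#
    sup = complete A (a , ≤-refl , a≤b , ga≤0) (b , λ _ (_ , t≤b , _) → t≤b)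
    c   = proj₁ sup
    A≤c = proj₁ (proj₂ sup)
    lub = proj₂ (proj₂ sup)
    a≤c = A≤c a (≤-refl , a≤b , ga≤0)
    c≤b = lub b λ _ (_ , t≤b , _) → t≤b
    lip′ : ∀ s t → a ≤ s → s ≤ t → t ≤ b → g t ≤ g s + M * (t - s)
    lip′ s t a≤s s≤t t≤b = begin
      g t                    ≤⟨ lip s t a≤s s≤t t≤b ⟩
      g s + L * (t - s)      ≤⟨ ≤-by (x≤y⇒0≤y-x s≤t)
        (solve 4 (λ G L s t → (G :+ (L :+ con (+ 1)) :* (t :- s)) :- (G :+ L :* (t :- s)) := t :- s)
          refl (g s) L s t) ⟩
      g s + M * (t - s)      ∎
    M*M⁻¹ : ∀ x → M * (M ⁻¹ * x) ≈ x
    M*M⁻¹ x = ⁻¹-cancelʳ x (pos⇒≉0 0<M)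
    gc≯0 : ¬ (0# < g c)
    gc≯0 0<gc = <⇒≱ 0<δ (begin
      δ              ≈⟨ solve 2 (λ c d → d := c :- (c :- d)) refl c δ ⟩
      c - (c - δ)    ≤⟨ +-monoˡ-≤ (- (c - δ)) (lub (c - δ) bound) ⟩
      c - δ - (c - δ) ≈⟨ -‿inverseʳ _ ⟩
      0#             ∎)
      where
      δ = M ⁻¹ * g c
      0<δ = *-pos (⁻¹-pos 0<M) 0<gc
      -- Growing at slope at most `M`, `g` needs a distance of at least `δ` to rise from a
      -- nonpositive value to `g c`. So `c - δ` would be an upper bound below the supremum.
      bound : ∀ t → A t → t ≤ c - δ
      bound t At@(a≤t , t≤b , gt≤0) = *-cancelˡ-≤ 0<M
        (≤-by (+-nonNeg (x≤y⇒0≤y-x (lip′ t c a≤t (A≤c t At) c≤b)) (x≤y⇒0≤y-x gt≤0))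
        (begin-equality
          M * (c - δ) - M * t            ≈⟨
                solve 4 (λ m c d t → m :* (c :- d) :- m :* t := m :* (c :- t) :- m :* d)
                  refl M c δ t ⟩
          M * (c - t) - M * δ            ≈⟨ +-congˡ (-‿cong (M*M⁻¹ (g c))) ⟩
          M * (c - t) - g c              ≈⟨
                solve 3 (λ p q r → p :- q := (r :+ p :- q) :+ (con (+ 0) :- r))
                  refl (M * (c - t)) (g c) (g t) ⟩
          (g t + M * (c - t) - g c) + (0# - g t) ∎))
    gc≮0 : ¬ (g c < 0#)
    -- From a negative `g c`, `g` stays nonpositive for a distance `δ` to the right. If that reaches
    -- `b`, then `b` lies in `A`, so `b ≤ c` and `g b` is negative; otherwise `c + δ` lies in `A`
    -- beyond its supremum.
    gc≮0 gc<0 with total b (c + M ⁻¹ * - g c)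
    ... | inj₁ b≤c+δ = <⇒≱ gc<0 (begin
      0#       ≤⟨ 0≤gb ⟩
      g b      ≤⟨ lip′ c b a≤c c≤b ≤-refl ⟩
      g c + M * (b - c)  ≤⟨ +-mono-≤ ≤-refl (*-monoˡ-≤ (<⇒≤ 0<M) (+-monoˡ-≤ (- c) b≤c)) ⟩
      g c + M * (c - c)  ≈⟨ solve 3 (λ G m c → G :+ m :* (c :- c) := G) refl (g c) M c ⟩
      g c                ∎)
      where
      b≤c = A≤c b (a≤b , ≤-refl , (begin
        g b                ≤⟨ lip′ c b a≤c c≤b ≤-refl ⟩
        g c + M * (b - c)  ≤⟨ +-mono-≤ ≤-refl (*-monoˡ-≤ (<⇒≤ 0<M) (+-monoˡ-≤ (- c) b≤c+δ)) ⟩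
        g c + M * (c + M ⁻¹ * - g c - c) ≈⟨ +-congˡ (*-congˡ (solve 2 (λ c d → c :+ d :- c := d)
              refl c _)) ⟩
        g c + M * (M ⁻¹ * - g c)         ≈⟨ +-congˡ (M*M⁻¹ _) ⟩
        g c - g c                        ≈⟨ -‿inverseʳ _ ⟩
        0#                               ∎))
    ... | inj₂ c+δ≤b = <⇒≱ 0<δ (begin
      δ          ≈⟨ solve 2 (λ c d → d := c :+ d :- c) refl c δ ⟩
      c + δ - c  ≤⟨ +-monoˡ-≤ (- c) (A≤c (c + δ) (≤-trans a≤c c≤c+δ , c+δ≤b , gc+δ≤0)) ⟩
      c - c      ≈⟨ -‿inverseʳ c ⟩
      0#         ∎)
      where
      δ = M ⁻¹ * - g c
      0<δ : 0# < δ
      0<δ = *-pos (⁻¹-pos 0<M) (≰⇒> λ -gc≤0 → <⇒≱ gc<0 (≤-by (x≤y⇒0≤y-x -gc≤0)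
              (solve 1 (λ G → G :- con (+ 0) := con (+ 0) :- (:- G)) refl (g c))))
      c≤c+δ : c ≤ c + δ
      c≤c+δ = ≤-by (<⇒≤ 0<δ) (solve 2 (λ c d → c :+ d :- c := d) refl c δ)
      gc+δ≤0 : g (c + δ) ≤ 0#
      gc+δ≤0 = begin
        g (c + δ)                ≤⟨ lip′ c (c + δ) a≤c c≤c+δ c+δ≤b ⟩
        g c + M * (c + δ - c)    ≈⟨ +-congˡ (*-congˡ (solve 2 (λ c d → c :+ d :- c := d)
              refl c δ)) ⟩
        g c + M * δ              ≈⟨ +-congˡ (M*M⁻¹ _) ⟩
        g c - g c                ≈⟨ -‿inverseʳ _ ⟩
        0#                       ∎

-- The curvature function of an abstract form.

module CurvatureForms {ℓ : Level} (em : ExcludedMiddle ℓ) (ℝ : RealField ℓ) where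
  open RealField ℝ
  open Curvature em ℝ using (the; the-spec; ]0,∞]; fin; ∞; 1/_; BalancedValue; LimitAt∞; _⋆_)
  open IntegerCoefficients ℝ
  open OrderedField em ℝ
  open ≤-Reasoning poset

  -- What the argument needs of Δ f (x), Γ(f)(x) and Γ₂(f)(x) as functions of f.
  record Form : Set (lsuc ℓ) where
    field
      F       : Set ℓ
      α γ γ₂  : F → Carrier
      C K₀    : Carrier
      0≤C     : 0# ≤ C
      0≤γ     : ∀ f → 0# ≤ γ f
      α²≤Cγ   : ∀ f → α f * α f ≤ C * γ f
      K₀γ≤γ₂  : ∀ f → K₀ * γ f ≤ γ₂ f
      scale   : ∀ t f → ∃[ g ] (α g ≈ t * α f × γ g ≈ t * t * γ f × γ₂ g ≈ t * t * γ₂ f)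
      f₀      : F
      αf₀≉0   : ¬ (α f₀ ≈ 0#)

    -- The parameter s stands for 1/𝒩.
    CD : Carrier → Carrier → Set ℓ
    CD s K = ∀ f → s * (α f * α f) + K * γ f ≤ γ₂ f

    IsMaximal : Carrier → Carrier → Set ℓ
    IsMaximal s K = CD s K × (∀ K′ → CD s K′ → K′ ≤ K)

    κ : Carrier → Carrier
    κ s = the (IsMaximal s)

    maximal-unique : ∀ {s K K′} → IsMaximal s K → IsMaximal s K′ → K ≈ K′
    maximal-unique (cd , max) (cd′ , max′) = antisym (max′ _ cd) (max _ cd′)

    CD-mono : ∀ {s s′ K K′} → s′ ≤ s → K′ ≤ K → CD s K → CD s′ K′
    CD-mono s′≤s K′≤K cd f = ≤-trans
      (+-mono-≤ (*-monoʳ-≤ (0≤x² (α f)) s′≤s) (*-monoʳ-≤ (0≤γ f) K′≤K))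
      (cd f)

    -- Raising `s` adds (s′ - s) α² to the left side, and α² ≤ C γ lets a decrease of `K` absorb it.
    -- This is the source of the Lipschitz bound.
    CD-shift : ∀ {s s′ K} → s ≤ s′ → CD s K → CD s′ (K - C * (s′ - s))
    CD-shift {s} {s′} {K} s≤s′ cd f = begin
      s′ * (α f * α f) + (K - C * (s′ - s)) * γ f
        ≤⟨ ≤-by (*-nonNeg (x≤y⇒0≤y-x s≤s′) (x≤y⇒0≤y-x (α²≤Cγ f)))
             (solve 6 (λ s s′ K C a g →
                (s :* a :+ K :* g) :- (s′ :* a :+ (K :- C :* (s′ :- s)) :* g)
                := (s′ :- s) :* (C :* g :- a)) refl s s′ K C (α f * α f) (γ f)) ⟩
      s * (α f * α f) + K * γ f
        ≤⟨ cd f ⟩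
      γ₂ f ∎

    0<γf₀ : 0# < γ f₀
    0<γf₀ = ≰⇒> λ γ≤0 → <⇒≱ (0<x² αf₀≉0) (begin
      α f₀ * α f₀  ≤⟨ α²≤Cγ f₀ ⟩
      C * γ f₀     ≤⟨ *-monoˡ-≤ 0≤C γ≤0 ⟩
      C * 0#       ≈⟨ zeroʳ C ⟩
      0#           ∎)

    CD-bound : ∀ {s K f} → 0# < γ f → CD s K → K ≤ γ f ⁻¹ * (γ₂ f - s * (α f * α f))
    CD-bound {s} {K} {f} 0<γ cd = begin
      K                                  ≈⟨ ⁻¹-cancelˡ K (pos⇒≉0 0<γ) ⟨
      γ f ⁻¹ * (γ f * K)                 ≤⟨ *-monoˡ-≤ (<⇒≤ (⁻¹-pos 0<γ))
        (≤-by (x≤y⇒0≤y-x (cd f))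
          (solve 4 (λ g₂ s K g → (g₂ :- s) :- g :* K := g₂ :- (s :+ K :* g))
            refl (γ₂ f) (s * (α f * α f)) K (γ f))) ⟩
      γ f ⁻¹ * (γ₂ f - s * (α f * α f))  ∎

    -- Functions with γ = 0 put no constraint on `K`: there α²≤Cγ makes the left side at most 0,
    -- while K₀γ≤γ₂ makes γ₂ nonnegative. The condition is thus a family of upper bounds on `K`,
    -- which passes to suprema.
    CD-from-bounds : ∀ {s K} → 0# ≤ s →
      (∀ f → 0# < γ f → K ≤ γ f ⁻¹ * (γ₂ f - s * (α f * α f))) → CD s K
    CD-from-bounds {s} {K} 0≤s bound = cd
      where
      cd : CD s K
      cd f with em {0# < γ f}
      ... | yes 0<γ = ≤-by
        (x≤y⇒0≤y-x (*-monoˡ-≤ (<⇒≤ 0<γ) (bound f 0<γ)))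
        (begin-equality
          γ₂ f - (s * (α f * α f) + K * γ f)
            ≈⟨ solve 4 (λ g₂ s K g → g₂ :- (s :+ K :* g) := (g₂ :- s) :- g :* K)
                 refl (γ₂ f) (s * (α f * α f)) K (γ f) ⟩
          (γ₂ f - s * (α f * α f)) - γ f * K
            ≈⟨ +-congʳ (⁻¹-cancelʳ _ (pos⇒≉0 0<γ)) ⟨
          γ f * (γ f ⁻¹ * (γ₂ f - s * (α f * α f))) - γ f * K ∎)
      ... | no  γ≯0 = begin
        s * (α f * α f) + K * γ f
          ≤⟨ +-mono-≤ (*-monoˡ-≤ 0≤s (α²≤Cγ f)) ≤-refl ⟩
        s * (C * γ f) + K * γ f
          ≈⟨ solve 5 (λ s C g K K₀ → s :* (C :* g) :+ K :* g := K₀ :* g :+ g :* (s :* C :+ K :- K₀))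
               refl s C (γ f) K K₀ ⟩
        K₀ * γ f + γ f * (s * C + K - K₀)
          ≈⟨ +-congˡ (trans (*-congʳ γ≈0) (zeroˡ _)) ⟩
        K₀ * γ f + 0#
          ≈⟨ +-identityʳ _ ⟩
        K₀ * γ f
          ≤⟨ K₀γ≤γ₂ f ⟩
        γ₂ f ∎
        where
        γ≈0 : γ f ≈ 0#
        γ≈0 = antisym (≮⇒≥ γ≯0) (0≤γ f)

    -- The supremum of the admissible `K` is itself admissible, since it respects every upper bound.
    -- Shifting `K₀` from s = 0 shows that there is an admissible value, and testing on `f₀` bounds
    -- them all.
    maximal-exists : ∀ {s} → 0# ≤ s → ∃ (IsMaximal s)
    maximal-exists {s} 0≤s = K , CD-from-bounds 0≤s (λ f 0<γ → lub _ (bounded 0<γ)) , ub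
      where
      bounded : ∀ {f} → 0# < γ f → ∀ K → CD s K → K ≤ γ f ⁻¹ * (γ₂ f - s * (α f * α f))
      bounded 0<γ K = CD-bound 0<γ
      cd₀ : CD 0# K₀
      cd₀ f = begin
        0# * (α f * α f) + K₀ * γ f  ≈⟨ +-congʳ (zeroˡ _) ⟩
        0# + K₀ * γ f                ≈⟨ +-identityˡ _ ⟩
        K₀ * γ f                     ≤⟨ K₀γ≤γ₂ f ⟩
        γ₂ f                         ∎
      sup = complete (CD s) (K₀ - C * (s - 0#) , CD-shift 0≤s cd₀)
              (γ f₀ ⁻¹ * (γ₂ f₀ - s * (α f₀ * α f₀)) , bounded 0<γf₀)
      K   = proj₁ sup
      ub  = proj₁ (proj₂ sup)
      lub = proj₂ (proj₂ sup)

    κ-maximal : ∀ {s} → 0# ≤ s → IsMaximal s (κ s)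
    κ-maximal 0≤s = the-spec _ (maximal-exists 0≤s)

    κ-anti : ∀ {s s′} → 0# ≤ s → s ≤ s′ → κ s′ ≤ κ s
    κ-anti 0≤s s≤s′ = proj₂ (κ-maximal 0≤s) _
      (CD-mono s≤s′ ≤-refl (proj₁ (κ-maximal (≤-trans 0≤s s≤s′))))

    κ-cong : ∀ {s s′} → 0# ≤ s → s ≈ s′ → κ s ≈ κ s′
    κ-cong 0≤s s≈s′ = antisym
      (κ-anti (≤-trans 0≤s (≤-reflexive s≈s′)) (≤-reflexive (sym s≈s′)))
      (κ-anti 0≤s (≤-reflexive s≈s′))

    κ-lipschitz : ∀ {s s′} → 0# ≤ s → s ≤ s′ → κ s ≤ κ s′ + C * (s′ - s)
    κ-lipschitz {s} {s′} 0≤s s≤s′ = ≤-by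
      (x≤y⇒0≤y-x (proj₂ (κ-maximal (≤-trans 0≤s s≤s′)) _
        (CD-shift s≤s′ (proj₁ (κ-maximal 0≤s)))))
      (solve 3 (λ k k′ x → (k′ :+ x) :- k := k′ :- (k :- x)) refl (κ s) (κ s′) _)

    -- Testing on `f₀` gives γ κ(s) ≤ γ₂ - s α² with α ≠ 0; the threshold is the `s` at which the
    -- right side equals B γ.
    κ-unbounded : ∀ B → ∃[ s₀ ] (∀ s → 0# ≤ s → s₀ ≤ s → κ s ≤ B)
    κ-unbounded B = a² ⁻¹ * (γ₂ f₀ - B * γ f₀) , λ s 0≤s s₀≤s → *-cancelˡ-≤ 0<γf₀ (begin
      γ f₀ * κ s
        ≤⟨ ≤-by (x≤y⇒0≤y-x (proj₁ (κ-maximal 0≤s) f₀))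
             (solve 4 (λ g₂ s K g → (g₂ :- s) :- g :* K := g₂ :- (s :+ K :* g))
               refl (γ₂ f₀) (s * a²) (κ s) (γ f₀)) ⟩
      γ₂ f₀ - s * a²
        ≤⟨ ≤-by (x≤y⇒0≤y-x (*-monoˡ-≤ (<⇒≤ 0<a²) s₀≤s))
             (solve 2 (λ x r → x :+ r :- x := r) refl _ _) ⟩
      γ₂ f₀ - s * a² + (a² * s - a² * (a² ⁻¹ * (γ₂ f₀ - B * γ f₀)))
        ≈⟨ +-congˡ (+-congˡ (-‿cong (⁻¹-cancelʳ _ (pos⇒≉0 0<a²)))) ⟩
      γ₂ f₀ - s * a² + (a² * s - (γ₂ f₀ - B * γ f₀))
        ≈⟨ solve 5 (λ g₂ s a B g → g₂ :- s :* a :+ (a :* s :- (g₂ :- B :* g)) := g :* B)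
             refl (γ₂ f₀) s a² B (γ f₀) ⟩
      γ f₀ * B ∎)
      where
      a² = α f₀ * α f₀
      0<a² = 0<x² αf₀≉0


    -- The inequality is homogeneous of degree two in `f`, so a function with α ≠ 0 may be rescaled
    -- to α = n, where n⁻¹ α² is simply `n`.
    CD-normalised : ∀ {n K} → 0# < n →
      (∀ f → α f ≈ 0# → K * γ f ≤ γ₂ f) →
      (∀ f → α f ≈ n → n + K * γ f ≤ γ₂ f) → CD (n ⁻¹) K
    CD-normalised {n} {K} 0<n cd₀ cdₙ f with em {α f ≈ 0#}
    ... | yes α≈0 = begin
      n ⁻¹ * (α f * α f) + K * γ f  ≈⟨ +-congʳ (*-congˡ (*-cong α≈0 α≈0)) ⟩
      n ⁻¹ * (0# * 0#) + K * γ f    ≈⟨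
            solve 2 (λ i k → i :* (con (+ 0) :* con (+ 0)) :+ k := k) refl (n ⁻¹) _ ⟩
      K * γ f                       ≤⟨ cd₀ f α≈0 ⟩
      γ₂ f                          ∎
    ... | no α≉0 with scale (n * α f ⁻¹) f
    ...   | g , αg , γg , γ₂g = *-cancelˡ-≤ (0<x² t≉0) (begin
      t * t * (n ⁻¹ * (α f * α f) + K * γ f)
        ≈⟨ solve 5 (λ t i a K g → t :* t :* (i :* (a :* a) :+ K :* g)
             := i :* ((t :* a) :* (t :* a)) :+ K :* (t :* t :* g)) refl t (n ⁻¹) (α f) K (γ f) ⟩
      n ⁻¹ * ((t * α f) * (t * α f)) + K * (t * t * γ f)
        ≈⟨ +-congʳ (*-congˡ (*-cong tα≈n tα≈n)) ⟩
      n ⁻¹ * (n * n) + K * (t * t * γ f)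
        ≈⟨ +-cong (⁻¹-cancelˡ n (pos⇒≉0 0<n)) (*-congˡ (sym γg)) ⟩
      n + K * γ g
        ≤⟨ cdₙ g (trans αg tα≈n) ⟩
      γ₂ g
        ≈⟨ γ₂g ⟩
      t * t * γ₂ f ∎)
      where
      t = n * α f ⁻¹
      tα≈n : t * α f ≈ n
      tα≈n = trans (solve 3 (λ n i a → n :* i :* a := i :* (a :* n)) refl n (α f ⁻¹) (α f))
                   (⁻¹-cancelˡ n α≉0)
      t≉0 : ¬ (t ≈ 0#)
      t≉0 t≈0 = pos⇒≉0 0<n (trans (sym tα≈n) (trans (*-congʳ t≈0) (zeroˡ _)))

    maximal-cong : ∀ {s s′ K K′} → s ≈ s′ → K ≈ K′ → IsMaximal s K → IsMaximal s′ K′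
    maximal-cong s≈s′ K≈K′ (cd , max) =
      CD-mono (≤-reflexive (sym s≈s′)) (≤-reflexive (sym K≈K′)) cd ,
      λ K″ cd″ → ≤-trans (max K″ (CD-mono (≤-reflexive s≈s′) ≤-refl cd″)) (≤-reflexive K≈K′)

    -- As a function of 𝒩 = t the curvature is Lipschitz away from 0, because 1/t - 1/t′ = (t′ -
    -- t)/(t t′) ≤ (t′ - t)/c².
    κ⁻¹-lipschitz : ∀ {c t t′} → 0# < c → c ≤ t → t ≤ t′ →
      κ (t′ ⁻¹) ≤ κ (t ⁻¹) + C * (c ⁻¹ * c ⁻¹) * (t′ - t)
    κ⁻¹-lipschitz {c} {t} {t′} 0<c c≤t t≤t′ = begin
      κ (t′ ⁻¹)
        ≤⟨ κ-lipschitz (<⇒≤ 0<t′⁻¹) (⁻¹-anti-≤ 0<t t≤t′) ⟩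
      κ (t ⁻¹) + C * (t ⁻¹ - t′ ⁻¹)
        ≈⟨ +-congˡ (*-congˡ (⁻¹-difference 0<t 0<t′)) ⟩
      κ (t ⁻¹) + C * ((t′ - t) * (t ⁻¹ * t′ ⁻¹))
        ≤⟨ +-mono-≤ ≤-refl (*-monoˡ-≤ 0≤C (*-monoˡ-≤ (x≤y⇒0≤y-x t≤t′)
             (≤-trans (*-monoˡ-≤ (<⇒≤ (⁻¹-pos 0<t)) (⁻¹-anti-≤ 0<c (≤-trans c≤t t≤t′)))
                      (*-monoʳ-≤ (<⇒≤ (⁻¹-pos 0<c)) (⁻¹-anti-≤ 0<c c≤t))))) ⟩
      κ (t ⁻¹) + C * ((t′ - t) * (c ⁻¹ * c ⁻¹))
        ≈⟨ +-congˡ (solve 3 (λ C d i → C :* (d :* i) := C :* i :* d) refl C _ _) ⟩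
      κ (t ⁻¹) + C * (c ⁻¹ * c ⁻¹) * (t′ - t) ∎
      where
      0<t = <-≤-trans 0<c c≤t
      0<t′ = <-≤-trans 0<t t≤t′
      0<t′⁻¹ = ⁻¹-pos 0<t′

  -- Sums of forms and balanced splittings.

  open Form

  -- The two maps need not be inverse to each other. `split` carries inequalities from the summands
  -- to `P`, for which a bound on γ₂ from below is enough; `join` carries them back and is exact.
  record IsSum (P Q R : Form) : Set ℓ where
    field
      split : ∀ h → Σ[ f ∈ F Q ] Σ[ g ∈ F R ]
        (α P h ≈ α Q f + α R g × γ P h ≈ γ Q f + γ R g × γ₂ Q f + γ₂ R g ≤ γ₂ P h)
      join  : ∀ f g → Σ[ h ∈ F P ]
        (α P h ≈ α Q f + α R g × γ P h ≈ γ Q f + γ R g × γ₂ P h ≈ γ₂ Q f + γ₂ R g)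

  -- With p = a/m and q = b/n, the right side exceeds the left by m n (p - q)²/(m + n).
  titu : ∀ {m n} a b → 0# < m → 0# < n →
    (m + n) ⁻¹ * ((a + b) * (a + b)) ≤ m ⁻¹ * (a * a) + n ⁻¹ * (b * b)
  titu {m} {n} a b 0<m 0<n = begin
    i * ((a + b) * (a + b))
      ≈⟨ *-congˡ (*-cong a+b a+b) ⟩
    i * ((m * p + n * q) * (m * p + n * q))
      ≤⟨ ≤-by (*-nonNeg (<⇒≤ (⁻¹-pos 0<m+n))
             (*-nonNeg (*-nonNeg (<⇒≤ 0<m) (<⇒≤ 0<n)) (0≤x² (p - q))))
           (solve 5 (λ i m n p q →
              (m :+ n) :* i :* (m :* (p :* p) :+ n :* (q :* q))
                :- i :* ((m :* p :+ n :* q) :* (m :* p :+ n :* q))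
              := i :* (m :* n :* ((p :- q) :* (p :- q)))) refl i m n p q) ⟩
    (m + n) * i * (m * (p * p) + n * (q * q))
      ≈⟨ trans (*-congʳ (x*x⁻¹≈1 0<m+n)) (*-identityˡ _) ⟩
    m * (p * p) + n * (q * q)
      ≈⟨ +-cong (square a 0<m) (square b 0<n) ⟩
    m ⁻¹ * (a * a) + n ⁻¹ * (b * b) ∎
    where
    i = (m + n) ⁻¹
    p = m ⁻¹ * a
    q = n ⁻¹ * b
    0<m+n = +-pos-nonNeg 0<m (<⇒≤ 0<n)
    unfold : ∀ {x} y → 0# < x → y ≈ x * (x ⁻¹ * y)
    unfold y 0<x = sym (⁻¹-cancelʳ y (pos⇒≉0 0<x))
    a+b : a + b ≈ m * p + n * q
    a+b = +-cong (unfold a 0<m) (unfold b 0<n)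
    square : ∀ {x} y → 0# < x → x * ((x ⁻¹ * y) * (x ⁻¹ * y)) ≈ x ⁻¹ * (y * y)
    square {x} y 0<x = begin-equality
      x * ((x ⁻¹ * y) * (x ⁻¹ * y))  ≈⟨
            solve 3 (λ x i y → x :* ((i :* y) :* (i :* y)) := i :* (x :* (i :* (y :* y))))
              refl x (x ⁻¹) y ⟩
      x ⁻¹ * (x * (x ⁻¹ * (y * y)))  ≈⟨ *-congˡ (unfold _ 0<x) ⟨
      x ⁻¹ * (y * y)                 ∎

  isSum-swap : ∀ {P Q R} → IsSum P Q R → IsSum P R Q
  isSum-swap σ = record
    { split = λ h → let (f , g , a , b , c) = split h in
        g , f , trans a (+-comm _ _) , trans b (+-comm _ _) ,
        ≤-trans (≤-reflexive (+-comm _ _)) c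
    ; join  = λ g f → let (h , a , b , c) = join f g in
        h , trans a (+-comm _ _) , trans b (+-comm _ _) , trans c (+-comm _ _)
    }
    where open IsSum σ

  CD-sum : ∀ {P Q R m n K} → IsSum P Q R → 0# < m → 0# < n →
    CD Q (m ⁻¹) K → CD R (n ⁻¹) K → CD P ((m + n) ⁻¹) K
  CD-sum {P} {Q} {R} {m} {n} {K} σ 0<m 0<n cdQ cdR h with IsSum.split σ h
  ... | f , g , αh , γh , γ₂h = begin
    (m + n) ⁻¹ * (α P h * α P h) + K * γ P h
      ≈⟨ +-cong (*-congˡ (*-cong αh αh)) (*-congˡ γh) ⟩
    (m + n) ⁻¹ * ((α Q f + α R g) * (α Q f + α R g)) + K * (γ Q f + γ R g)
      ≤⟨ +-mono-≤ (titu (α Q f) (α R g) 0<m 0<n) ≤-refl ⟩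
    m ⁻¹ * (α Q f * α Q f) + n ⁻¹ * (α R g * α R g) + K * (γ Q f + γ R g)
      ≈⟨ solve 5 (λ a b K x y → a :+ b :+ K :* (x :+ y) := (a :+ K :* x) :+ (b :+ K :* y))
           refl (m ⁻¹ * (α Q f * α Q f)) (n ⁻¹ * (α R g * α R g)) K (γ Q f) (γ R g) ⟩
    (m ⁻¹ * (α Q f * α Q f) + K * γ Q f) + (n ⁻¹ * (α R g * α R g) + K * γ R g)
      ≤⟨ +-mono-≤ (cdQ f) (cdR g) ⟩
    γ₂ Q f + γ₂ R g
      ≤⟨ γ₂h ⟩
    γ₂ P h ∎

  -- Joining `f` with the zero multiple of `f₀ R` leaves α, γ and γ₂ of `f` unchanged, so the
  -- inequality of `P` can be read on `Q` alone.
  CD-sum-kernel : ∀ {P Q R s K} → IsSum P Q R → CD P s K →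
    ∀ f → α Q f ≈ 0# → K * γ Q f ≤ γ₂ Q f
  CD-sum-kernel {P} {Q} {R} {s} {K} σ cd f αf≈0 with scale R 0# (f₀ R)
  ... | g , αg , γg , γ₂g with IsSum.join σ f g
  ...   | h , αh , γh , γ₂h = begin
    K * γ Q f                        ≈⟨
          solve 2 (λ s k → k := s :* (con (+ 0) :* con (+ 0)) :+ k) refl s _ ⟩
    s * (0# * 0#) + K * γ Q f        ≈⟨ +-cong (*-congˡ (*-cong αh≈0 αh≈0)) (*-congˡ γh≈γf) ⟨
    s * (α P h * α P h) + K * γ P h  ≤⟨ cd h ⟩
    γ₂ P h                           ≈⟨ γ₂h ⟩
    γ₂ Q f + γ₂ R g                  ≈⟨ +-congˡ γ₂g ⟩
    γ₂ Q f + 0# * 0# * γ₂ R (f₀ R)   ≈⟨ drop _ _ ⟩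
    γ₂ Q f                           ∎
    where
    drop : ∀ x y → x + 0# * 0# * y ≈ x
    drop = solve 2 (λ x y → x :+ con (+ 0) :* con (+ 0) :* y := x) refl
    αh≈0 : α P h ≈ 0#
    αh≈0 = trans αh (trans (+-cong αf≈0 (trans αg (zeroˡ _))) (+-identityˡ 0#))
    γh≈γf : γ P h ≈ γ Q f
    γh≈γf = trans γh (trans (+-congˡ γg) (drop _ _))

  -- A pair of functions violating both conclusions can be rescaled to
  -- α f = m and α g = n, which is the equality case of `titu`.
  CD-sum⁻¹ : ∀ {P Q R m n K} → IsSum P Q R → 0# < m → 0# < n →
    CD P ((m + n) ⁻¹) K → CD Q (m ⁻¹) K ⊎ CD R (n ⁻¹) K
  CD-sum⁻¹ {P} {Q} {R} {m} {n} {K} σ 0<m 0<n cd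
    with em {Σ[ f ∈ F Q ] (α Q f ≈ m × γ₂ Q f < m + K * γ Q f)}
  ... | no none = inj₁ (CD-normalised Q 0<m (CD-sum-kernel {P} {Q} {R} σ cd)
    (λ f αf≈m → ≮⇒≥ λ γ₂f< → none (f , αf≈m , γ₂f<)))
  ... | yes (f , αf≈m , γ₂f<) =
    inj₂ (CD-normalised R 0<n (CD-sum-kernel {P} {R} {Q} (isSum-swap {P} {Q} {R} σ) cd) cdₙ)
    where
    cdₙ : ∀ g → α R g ≈ n → n + K * γ R g ≤ γ₂ R g
    cdₙ g αg≈n with IsSum.join σ f g
    -- The inequality for the join of `f` and `g`, minus the violated one for `f`, is the inequality
    -- for `g`.
    ... | h , αh , γh , γ₂h = ≤-by
      (+-nonNeg (x≤y⇒0≤y-x cdh) (x≤y⇒0≤y-x (<⇒≤ γ₂f<)))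
      (solve 7 (λ u v m n K x y → v :- (n :+ K :* y) :=
          ((u :+ v) :- ((m :+ n) :+ K :* (x :+ y))) :+ ((m :+ K :* x) :- u))
        refl (γ₂ Q f) (γ₂ R g) m n K (γ Q f) (γ R g))
      where
      αh≈m+n : α P h ≈ m + n
      αh≈m+n = trans αh (+-cong αf≈m αg≈n)
      cdh : (m + n) + K * (γ Q f + γ R g) ≤ γ₂ Q f + γ₂ R g
      cdh = begin
        (m + n) + K * (γ Q f + γ R g)
          ≈⟨ +-cong (⁻¹-cancelˡ (m + n) (pos⇒≉0 (+-pos-nonNeg 0<m (<⇒≤ 0<n)))) (*-congˡ γh) ⟨
        (m + n) ⁻¹ * ((m + n) * (m + n)) + K * γ P h
          ≈⟨ +-congʳ (*-congˡ (*-cong αh≈m+n αh≈m+n)) ⟨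
        (m + n) ⁻¹ * (α P h * α P h) + K * γ P h
          ≤⟨ cd h ⟩
        γ₂ P h
          ≈⟨ γ₂h ⟩
        γ₂ Q f + γ₂ R g ∎

  -- The disjunction in `CD-sum⁻¹` is enough because the same `K` is maximal on both summands:
  -- whichever one admits K′, it follows that K′ ≤ K.
  maximal-sum : ∀ {P Q R m n K} → IsSum P Q R → 0# < m → 0# < n →
    IsMaximal Q (m ⁻¹) K → IsMaximal R (n ⁻¹) K → IsMaximal P ((m + n) ⁻¹) K
  maximal-sum {P} {Q} {R} σ 0<m 0<n (cdQ , maxQ) (cdR , maxR) =
    CD-sum {P} {Q} {R} σ 0<m 0<n cdQ cdR ,
    λ K′ cd → [ maxQ K′ , maxR K′ ]′ (CD-sum⁻¹ {P} {Q} {R} σ 0<m 0<n cd)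

  -- The difference of the two sides, as a function of `t`, changes sign on an interval [c, N - c]
  -- and is Lipschitz there.
  balance-exists : ∀ Q R {N} → 0# < N →
    ∃[ t ] (0# < t × 0# < N - t × κ Q (t ⁻¹) ≈ κ R ((N - t) ⁻¹))
  balance-exists Q R {N} 0<N = result
    where
    M = ½ * N
    0<M : 0# < M
    0<M = *-pos (⁻¹-pos 0<2) 0<N
    N-M≈M : N - M ≈ M
    N-M≈M = begin-equality
      N - M              ≈⟨ +-congʳ (*-identityˡ N) ⟨
      1# * N - M         ≈⟨ +-congʳ (*-congʳ ½+½≈1) ⟨
      (½ + ½) * N - M    ≈⟨ solve 2 (λ h N → (h :+ h) :* N :- h :* N := h :* N) refl ½ N ⟩
      M                  ∎

    -- At distance c from either end of ]0,N[, one side is below the value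
    -- that the other takes at the midpoint.
    sQ = κ-unbounded Q (κ R (M ⁻¹))
    sR = κ-unbounded R (κ Q (M ⁻¹))
    -- `s` dominates both thresholds and also M⁻¹; the latter keeps c = s⁻¹ at or below the midpoint
    -- `M`.
    s₁ = upperBound₂ (proj₁ sQ) (proj₁ sR)
    s₂ = upperBound₂ (proj₁ s₁) (M ⁻¹)
    s = proj₁ s₂
    0<s : 0# < s
    0<s = <-≤-trans (⁻¹-pos 0<M) (proj₂ (proj₂ s₂))
    c = s ⁻¹
    0<c = ⁻¹-pos 0<s
    c≤M : c ≤ M
    c≤M = ≤-trans (⁻¹-anti-≤ (⁻¹-pos 0<M) (proj₂ (proj₂ s₂))) (≤-reflexive (⁻¹-involutive 0<M))
    c⁻¹≈s = ⁻¹-involutive 0<s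
    low : ∀ T B (u : ∃[ s₀ ] (∀ s → 0# ≤ s → s₀ ≤ s → κ T s ≤ B)) → proj₁ u ≤ s → κ T (c ⁻¹) ≤ B
    low T B (s₀ , u) s₀≤s = u (c ⁻¹) (<⇒≤ (⁻¹-pos 0<c)) (≤-trans s₀≤s (≤-reflexive (sym c⁻¹≈s)))
    M≤N-c : M ≤ N - c
    M≤N-c = ≤-by (x≤y⇒0≤y-x c≤M) (trans (+-congˡ (-‿cong (sym N-M≈M)))
              (solve 3 (λ N c M → (N :- c) :- (N :- M) := M :- c) refl N c M))
    high : ∀ T → κ T (M ⁻¹) ≤ κ T ((N - c) ⁻¹)
    high T = κ-anti T (<⇒≤ (⁻¹-pos (<-≤-trans 0<M M≤N-c))) (⁻¹-anti-≤ 0<M M≤N-c)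

    g : Carrier → Carrier
    g t = κ Q (t ⁻¹) - κ R ((N - t) ⁻¹)
    LQ = C Q * (c ⁻¹ * c ⁻¹)
    LR = C R * (c ⁻¹ * c ⁻¹)
    N-[N-x] : ∀ x → N - (N - x) ≈ x
    N-[N-x] x = solve 2 (λ N x → N :- (N :- x) := x) refl N x
    c≤N-c : c ≤ N - c
    c≤N-c = ≤-trans c≤M M≤N-c
    reflect : ∀ {t} → t ≤ N - c → c ≤ N - t
    reflect {t} t≤ = ≤-by (x≤y⇒0≤y-x t≤)
      (solve 3 (λ N t c → (N :- t) :- c := (N :- c) :- t) refl N t c)
    -- As `t` increases, `N - t` decreases; the bound for the subtracted term is therefore applied
    -- from `N - t′` up to `N - t`.
    lip : ∀ t t′ → c ≤ t → t ≤ t′ → t′ ≤ N - c → g t′ ≤ g t + (LQ + LR) * (t′ - t)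
    lip t t′ c≤t t≤t′ t′≤N-c = ≤-by
      (+-nonNeg (x≤y⇒0≤y-x (κ⁻¹-lipschitz Q 0<c c≤t t≤t′))
                (x≤y⇒0≤y-x (κ⁻¹-lipschitz R 0<c (reflect t′≤N-c)
                  (≤-by (x≤y⇒0≤y-x t≤t′)
                    (solve 3 (λ N t t′ → (N :- t) :- (N :- t′) := t′ :- t) refl N t t′)))))
      (solve 9 (λ a a′ b b′ L L′ t t′ N →
          (a :- b :+ (L :+ L′) :* (t′ :- t)) :- (a′ :- b′)
          := (a :+ L :* (t′ :- t) :- a′) :+ (b′ :+ L′ :* ((N :- t) :- (N :- t′)) :- b))
        refl (κ Q (t ⁻¹)) (κ Q (t′ ⁻¹)) (κ R ((N - t) ⁻¹)) (κ R ((N - t′) ⁻¹)) LQ LR t t′ N)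
    0≤L : 0# ≤ LQ + LR
    0≤L = +-nonNeg (*-nonNeg (0≤C Q) (0≤x² (c ⁻¹))) (*-nonNeg (0≤C R) (0≤x² (c ⁻¹)))
    gc≤0 : g c ≤ 0#
    gc≤0 = begin
      κ Q (c ⁻¹) - κ R ((N - c) ⁻¹)
        ≤⟨ +-monoˡ-≤ _ (≤-trans
             (low Q _ sQ (≤-trans (proj₁ (proj₂ s₁)) (proj₁ (proj₂ s₂)))) (high R)) ⟩
      κ R ((N - c) ⁻¹) - κ R ((N - c) ⁻¹)
        ≈⟨ -‿inverseʳ _ ⟩
      0# ∎
    0≤gN-c : 0# ≤ g (N - c)
    0≤gN-c = x≤y⇒0≤y-x (begin
      κ R ((N - (N - c)) ⁻¹)
        ≈⟨ κ-cong R (<⇒≤ (⁻¹-pos 0<c)) (⁻¹-cong 0<c (sym (N-[N-x] c))) ⟨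
      κ R (c ⁻¹)
        ≤⟨ low R _ sR (≤-trans (proj₂ (proj₂ s₁)) (proj₁ (proj₂ s₂))) ⟩
      κ Q (M ⁻¹)
        ≤⟨ high Q ⟩
      κ Q ((N - c) ⁻¹) ∎)
    root = zeroOfLipschitz g c (N - c) (LQ + LR) 0≤L c≤N-c lip gc≤0 0≤gN-c
    result : ∃[ t ] (0# < t × 0# < N - t × κ Q (t ⁻¹) ≈ κ R ((N - t) ⁻¹))
    result =
      let (t , c≤t , t≤N-c , gt≈0) = root in
      t , <-≤-trans 0<c c≤t , <-≤-trans 0<c (reflect t≤N-c) , (begin-equality
        κ Q (t ⁻¹)
          ≈⟨ solve 2 (λ x y → x := (x :- y) :+ y) refl _ _ ⟩
        g t + κ R ((N - t) ⁻¹)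
          ≈⟨ +-congʳ gt≈0 ⟩
        0# + κ R ((N - t) ⁻¹)
          ≈⟨ +-identityˡ _ ⟩
        κ R ((N - t) ⁻¹) ∎)

  -- The ⋆-product of curvature functions and its limit at infinity.

  𝒦-of : Form → ]0,∞] → Carrier
  𝒦-of P N = κ P (1/ N)

  balancedValue-exists : ∀ Q R {N} → 0# < N → ∃ (BalancedValue (𝒦-of Q) (𝒦-of R) N)
  balancedValue-exists Q R {N} 0<N =
    let (t , 0<t , 0<N-t , eq) = balance-exists Q R 0<N in
    κ Q (t ⁻¹) , t , N - t , 0<t , 0<N-t ,
    solve 2 (λ t N → t :+ (N :- t) := N) refl t N , refl , eq

  -- This holds for every splitting, so `maximal-unique` identifies the value chosen by `the`
  -- whichever splitting produced it.
  balancedValue-maximal : ∀ {P Q R N v} → IsSum P Q R →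
    BalancedValue (𝒦-of Q) (𝒦-of R) N v → IsMaximal P (N ⁻¹) v
  balancedValue-maximal {P} {Q} {R} σ (N₁ , N₂ , 0<N₁ , 0<N₂ , N₁+N₂≈N , v≈Q , v≈R) =
    maximal-cong P (⁻¹-cong (+-pos-nonNeg 0<N₁ (<⇒≤ 0<N₂)) N₁+N₂≈N) refl
      (maximal-sum {P} {Q} {R} σ 0<N₁ 0<N₂ (maximal Q 0<N₁ v≈Q) (maximal R 0<N₂ v≈R))
    where
    maximal : ∀ T {n v} → 0# < n → v ≈ κ T (n ⁻¹) → IsMaximal T (n ⁻¹) v
    maximal T 0<n v≈ = maximal-cong T refl (sym v≈) (κ-maximal T (<⇒≤ (⁻¹-pos 0<n)))

  balancedValue≈κ : ∀ P Q R {N} → IsSum P Q R → 0# < N →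
    the (BalancedValue (𝒦-of Q) (𝒦-of R) N) ≈ κ P (N ⁻¹)
  balancedValue≈κ P Q R {N} σ 0<N = maximal-unique P
    (balancedValue-maximal {P} {Q} {R} σ (the-spec _ (balancedValue-exists Q R 0<N)))
    (κ-maximal P (<⇒≤ (⁻¹-pos 0<N)))

  x-ε<x : ∀ {ε} x → 0# < ε → x - ε < x
  x-ε<x {ε} x 0<ε = ≰⇒> λ x≤x-ε → <⇒≱ 0<ε (≤-by (x≤y⇒0≤y-x x≤x-ε)
    (solve 2 (λ x e → con (+ 0) :- e := (x :- e) :- x) refl x ε))

  x<x+ε : ∀ {ε} x → 0# < ε → x < x + ε
  x<x+ε {ε} x 0<ε = ≰⇒> λ x+ε≤x → <⇒≱ 0<ε (≤-by (x≤y⇒0≤y-x x+ε≤x)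
    (solve 2 (λ x e → con (+ 0) :- e := x :- (x :+ e)) refl x ε))

  -- Monotonicity and the Lipschitz bound at s = 0 give κ(0) - C/N ≤ κ(1/N) ≤ κ(0).
  κ-limit : ∀ P (h : ∀ N → 0# < N → Carrier) →
    (∀ N (0<N : 0# < N) → h N 0<N ≈ κ P (N ⁻¹)) → LimitAt∞ h (κ P 0#)
  κ-limit P h h≈κ ε 0<ε = M , λ N 0<N M≤N →
    (begin-strict
      κ P 0# - ε
        ≤⟨ +-monoˡ-≤ (- ε) (κ-lipschitz P ≤-refl (<⇒≤ (⁻¹-pos 0<N))) ⟩
      κ P (N ⁻¹) + C P * (N ⁻¹ - 0#) - ε
        ≈⟨ solve 4 (λ k c i e → k :+ c :* (i :- con (+ 0)) :- e := k :- (e :- c :* i))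
             refl _ (C P) (N ⁻¹) ε ⟩
      κ P (N ⁻¹) - (ε - C P * N ⁻¹)
        <⟨ x-ε<x _ (0<ε-CN⁻¹ N 0<N M≤N) ⟩
      κ P (N ⁻¹)
        ≈⟨ h≈κ N 0<N ⟨
      h N 0<N ∎) ,
    (begin-strict
      h N 0<N     ≈⟨ h≈κ N 0<N ⟩
      κ P (N ⁻¹)  ≤⟨ κ-anti P ≤-refl (<⇒≤ (⁻¹-pos 0<N)) ⟩
      κ P 0#      <⟨ x<x+ε _ 0<ε ⟩
      κ P 0# + ε  ∎)
    where
    -- For N ≥ (C + 1)/ε one has ε N - C ≥ 1, which makes ε - C/N strictly positive.
    M = ε ⁻¹ * (C P + 1#)
    0<ε-CN⁻¹ : ∀ N → 0# < N → M ≤ N → 0# < ε - C P * N ⁻¹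
    0<ε-CN⁻¹ N 0<N M≤N = ≰⇒> λ bad → <⇒≱ 0<1 (begin
      1#
        ≈⟨ solve 1 (λ c → con (+ 1) := c :+ con (+ 1) :- c) refl (C P) ⟩
      C P + 1# - C P
        ≈⟨ +-congʳ (⁻¹-cancelʳ _ (pos⇒≉0 0<ε)) ⟨
      ε * M - C P
        ≤⟨ +-monoˡ-≤ _ (*-monoˡ-≤ (<⇒≤ 0<ε) M≤N) ⟩
      ε * N - C P
        ≈⟨ +-congˡ (-‿cong (trans (*-congˡ (x*x⁻¹≈1 0<N)) (*-identityʳ _))) ⟨
      ε * N - C P * (N * N ⁻¹)
        ≈⟨ solve 4 (λ e N c i → e :* N :- c :* (N :* i) := N :* (e :- c :* i))
             refl ε N (C P) (N ⁻¹) ⟩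
      N * (ε - C P * N ⁻¹)
        ≤⟨ *-monoˡ-≤ (<⇒≤ 0<N) bad ⟩
      N * 0#
        ≈⟨ zeroʳ N ⟩
      0# ∎)

  -- If L′ < L, let ε be half the gap: then L′ + ε = L - ε, and h(N) for large `N` would lie
  -- strictly on both sides of that number. Taking N ≥ 1 as well ensures that `N` is positive.
  limit-≤ : ∀ {h L L′} → LimitAt∞ h L → LimitAt∞ h L′ → L ≤ L′
  limit-≤ {h} {L} {L′} lim lim′ = ≮⇒≥ λ L′<L →
    let ε           = ½ * (L - L′)
        0<L-L′      = ≰⇒> λ L-L′≤0 → <⇒≱ L′<L (≤-by (x≤y⇒0≤y-x L-L′≤0)
                        (solve 2 (λ l l′ → l′ :- l := con (+ 0) :- (l :- l′)) refl L L′))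
        0<ε         = *-pos (⁻¹-pos 0<2) 0<L-L′
        (M , near)  = lim ε 0<ε
        (M′ , near′) = lim′ ε 0<ε
        (N₀ , M≤ , M′≤) = upperBound₂ M M′
        (N , N₀≤N , 1≤N) = upperBound₂ N₀ 1#
        0<N         = <-≤-trans 0<1 1≤N
    in <⇒≱ (proj₁ (near N 0<N (≤-trans M≤ N₀≤N))) (begin
      h N 0<N          ≤⟨ <⇒≤ (proj₂ (near′ N 0<N (≤-trans M′≤ N₀≤N))) ⟩
      L′ + ε           ≈⟨
            solve 3 (λ l l′ h → l′ :+ h :* (l :- l′) := l :- (l :- l′) :+ h :* (l :- l′))
              refl L L′ ½ ⟩
      L - (L - L′) + ε ≈⟨ +-congʳ (+-congˡ (-‿cong (trans (*-congʳ ½+½≈1) (*-identityˡ _)))) ⟨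
      L - (½ + ½) * (L - L′) + ε ≈⟨
            solve 3 (λ l h d → l :- (h :+ h) :* d :+ h :* d := l :- h :* d) refl L ½ (L - L′) ⟩
      L - ε            ∎)

  κ-sum : ∀ P Q R → IsSum P Q R → ∀ N → κ P (1/ N) ≈ (𝒦-of Q ⋆ 𝒦-of R) N
  κ-sum P Q R σ (fin N 0<N) = sym (balancedValue≈κ P Q R σ 0<N)
  -- `κ P 0#` is a limit, so `the` selects a genuine limit, and limits are unique.
  κ-sum P Q R σ ∞ = antisym (limit-≤ {h} limit limit′) (limit-≤ {h} limit′ limit)
    where
    h : ∀ N → 0# < N → Carrier
    h N _ = the (BalancedValue (𝒦-of Q) (𝒦-of R) N)
    limit : LimitAt∞ h (κ P 0#)
    limit = κ-limit P h (λ N 0<N → balancedValue≈κ P Q R σ 0<N)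
    limit′ : LimitAt∞ h (the (LimitAt∞ h))
    limit′ = the-spec (LimitAt∞ h) (κ P 0# , limit)

-- Finite sums over lists.

module FiniteSums {ℓ : Level} (em : ExcludedMiddle ℓ) (ℝ : RealField ℓ) where
  open RealField ℝ
  open IntegerCoefficients ℝ
  open OrderedField em ℝ
  open ≤-Reasoning poset

  private variable
    A B : Set ℓ

  ∑ : List A → (A → Carrier) → Carrier
  ∑ xs g = foldr _+_ 0# (map g xs)

  ∑-cong : ∀ (xs : List A) {g h} → (∀ x → g x ≈ h x) → ∑ xs g ≈ ∑ xs h
  ∑-cong []       eq = refl
  ∑-cong (x ∷ xs) eq = +-cong (eq x) (∑-cong xs eq)

  ∑-+ : ∀ (xs : List A) g h → ∑ xs (λ x → g x + h x) ≈ ∑ xs g + ∑ xs h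
  ∑-+ []       g h = sym (+-identityˡ 0#)
  ∑-+ (x ∷ xs) g h = trans (+-congˡ (∑-+ xs g h))
    (solve 4 (λ a b c d → a :+ b :+ (c :+ d) := a :+ c :+ (b :+ d)) refl _ _ _ _)

  ∑-* : ∀ (xs : List A) c g → ∑ xs (λ x → c * g x) ≈ c * ∑ xs g
  ∑-* []       c g = sym (zeroʳ c)
  ∑-* (x ∷ xs) c g = trans (+-congˡ (∑-* xs c g)) (sym (distribˡ c _ _))

  ∑-difference : ∀ (xs : List A) g h → ∑ xs (λ x → g x - h x) ≈ ∑ xs g - ∑ xs h
  ∑-difference []       g h = sym (-‿inverseʳ 0#)
  ∑-difference (x ∷ xs) g h = trans (+-congˡ (∑-difference xs g h))
    (solve 4 (λ a b c d → (a :- b) :+ (c :- d) := (a :+ c) :- (b :+ d)) refl _ _ _ _)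

  ∑-0 : ∀ (xs : List A) → ∑ xs (λ _ → 0#) ≈ 0#
  ∑-0 []       = refl
  ∑-0 (x ∷ xs) = trans (+-identityˡ _) (∑-0 xs)

  ∑-swap : ∀ (xs : List A) (ys : List B) (g : A → B → Carrier) →
    ∑ xs (λ x → ∑ ys (g x)) ≈ ∑ ys (λ y → ∑ xs (λ x → g x y))
  ∑-swap []       ys g = sym (∑-0 ys)
  ∑-swap (x ∷ xs) ys g = trans (+-congˡ (∑-swap xs ys g)) (sym (∑-+ ys (g x) _))

  ∑-++ : ∀ (xs ys : List A) g → ∑ (xs ++ ys) g ≈ ∑ xs g + ∑ ys g
  ∑-++ []       ys g = sym (+-identityˡ _)
  ∑-++ (x ∷ xs) ys g = trans (+-congˡ (∑-++ xs ys g)) (sym (+-assoc _ _ _))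

  ∑-map : ∀ (k : A → B) xs g → ∑ (map k xs) g ≈ ∑ xs (λ x → g (k x))
  ∑-map k []       g = refl
  ∑-map k (x ∷ xs) g = +-congˡ (∑-map k xs g)

  ∑-nonNeg : ∀ (xs : List A) {g} → (∀ {x} → x ∈ xs → 0# ≤ g x) → 0# ≤ ∑ xs g
  ∑-nonNeg []       0≤g = ≤-refl
  ∑-nonNeg (x ∷ xs) 0≤g = +-nonNeg (0≤g (here ≡.refl)) (∑-nonNeg xs (λ x∈ → 0≤g (there x∈)))

  term≤∑ : ∀ {xs : List A} {x g} → (∀ x → 0# ≤ g x) → x ∈ xs → g x ≤ ∑ xs g
  term≤∑ {xs = x ∷ xs} 0≤g (here ≡.refl) = ≤-by (∑-nonNeg xs (λ {y} _ → 0≤g y))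
    (solve 2 (λ a b → a :+ b :- a := b) refl _ _)
  term≤∑ {xs = y ∷ xs} {x} {g} 0≤g (there x∈) = ≤-trans (term≤∑ 0≤g x∈) (≤-by (0≤g y)
    (solve 2 (λ a b → a :+ b :- b := a) refl (g y) _))

  -- For a list of length n this is 2ⁿ⁺¹ - 2.
  squareBound : List A → Carrier
  squareBound []       = 0#
  squareBound (x ∷ xs) = (1# + 1#) + (squareBound xs + squareBound xs)

  squareBound-nonNeg : ∀ (xs : List A) → 0# ≤ squareBound xs
  squareBound-nonNeg []       = ≤-refl
  squareBound-nonNeg (x ∷ xs) = +-nonNeg (+-nonNeg 0≤1 0≤1)
    (+-nonNeg (squareBound-nonNeg xs) (squareBound-nonNeg xs))

  -- Cauchy-Schwarz with the length replaced by a cruder constant, which is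
  -- enough and makes (a + b)² ≤ 2a² + 2b² the whole induction step.
  ∑²≤∑-squares : ∀ (xs : List A) g → ∑ xs g * ∑ xs g ≤ squareBound xs * ∑ xs (λ x → g x * g x)
  ∑²≤∑-squares []       g = ≤-reflexive refl
  ∑²≤∑-squares (x ∷ xs) g = ≤-by
    (+-nonNeg (0≤x² (g x - S)) (+-nonNeg
      (+-nonNeg 0≤IH 0≤IH)
      (+-nonNeg (+-nonNeg 0≤Q 0≤Q) (*-nonNeg (+-nonNeg 0≤c 0≤c) (0≤x² (g x))))))
    (solve 4 (λ a S c Q →
        ((con (+ 1) :+ con (+ 1)) :+ (c :+ c)) :* (a :* a :+ Q) :- (a :+ S) :* (a :+ S)
        := (a :- S) :* (a :- S) :+ (((c :* Q :- S :* S) :+ (c :* Q :- S :* S))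
             :+ ((Q :+ Q) :+ (c :+ c) :* (a :* a)))) refl (g x) S c Q)
    where
    S = ∑ xs g
    c = squareBound xs
    Q = ∑ xs (λ x → g x * g x)
    0≤IH = x≤y⇒0≤y-x (∑²≤∑-squares xs g)
    0≤c = squareBound-nonNeg xs
    0≤Q : 0# ≤ Q
    0≤Q = ∑-nonNeg xs (λ {y} _ → 0≤x² (g y))

-- The form of a graph at a vertex.

module GraphForms {ℓ : Level} (em : ExcludedMiddle ℓ) (ℝ : RealField ℓ) where
  open RealField ℝ
  open Curvature em ℝ using (Fun; Δ; Γ; Γ₂)
  open IntegerCoefficients ℝ
  open OrderedField em ℝ
  open FiniteSums em ℝ
  open CurvatureForms em ℝ
  open ≤-Reasoning poset

  module Local (G : Graph ℓ) where
    open Graph G using (nbrs)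

    D : Fun G → V G → Carrier
    D f x = ∑ (nbrs x) λ y → (f y - f x) * (f y - f x)

    -- The contribution of the neighbour `y` to 4Γ₂(f)(x), with `D` standing for 2Γ(f): the
    -- difference of `D` comes from ΔΓ(f), the two copies of `p` from Γ(f,Δf) and Γ(Δf,f).
    e : Fun G → V G → V G → Carrier
    e f x y = (D f y - D f x) - p - p
      where p = (f y - f x) * (Δ G f y - Δ G f x)

    E : Fun G → V G → Carrier
    E f x = ∑ (nbrs x) (e f x)

    Γ≈ : ∀ f g x → Γ G f g x ≈ ½ * ∑ (nbrs x) (λ y → (f y - f x) * (g y - g x))
    Γ≈ f g x = *-congˡ (polarize (nbrs x))
      where
      polarize : ∀ xs → ∑ xs (λ y → f y * g y - f x * g x)
                          - f x * ∑ xs (λ y → g y - g x) - g x * ∑ xs (λ y → f y - f x)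
                        ≈ ∑ xs (λ y → (f y - f x) * (g y - g x))
      polarize []       = solve 2 (λ a b → con (+ 0) :- a :* con (+ 0) :- b :* con (+ 0)
            := con (+ 0))
                            refl (f x) (g x)
      polarize (y ∷ ys) = trans
        (solve 7 (λ fx gx fy gy a b c →
            ((fy :* gy :- fx :* gx) :+ a) :- fx :* ((gy :- gx) :+ b) :- gx :* ((fy :- fx) :+ c)
            := (fy :- fx) :* (gy :- gx) :+ (a :- fx :* b :- gx :* c))
          refl (f x) (g x) (f y) (g y) _ _ _)
        (+-congˡ (polarize ys))

    Γ≈½D : ∀ f x → Γ G f f x ≈ ½ * D f x
    Γ≈½D f x = Γ≈ f f x

    Γ₂≈¼E : ∀ f x → Γ₂ G f f x ≈ ½ * (½ * E f x)
    Γ₂≈¼E f x = *-congˡ (begin-equality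
      Δ G (Γ G f f) x - Γ G f (Δ G f) x - Γ G (Δ G f) f x
        ≈⟨ +-cong (+-cong ΔΓ (-‿cong (Γ≈ f (Δ G f) x))) (-‿cong (trans (Γ≈ (Δ G f) f x)
             (*-congˡ (∑-cong (nbrs x) (λ y → *-comm _ _))))) ⟩
      ½ * ∑ (nbrs x) (λ y → D f y - D f x) - ½ * ∑ (nbrs x) p - ½ * ∑ (nbrs x) p
        ≈⟨ solve 3 (λ h a b → h :* a :- h :* b :- h :* b := h :* (a :- b :- b)) refl ½ _ _ ⟩
      ½ * (∑ (nbrs x) (λ y → D f y - D f x) - ∑ (nbrs x) p - ∑ (nbrs x) p)
        ≈⟨ *-congˡ (trans (∑-difference (nbrs x) _ p) (+-congʳ (∑-difference (nbrs x) _ p))) ⟨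
      ½ * E f x ∎)
      where
      p : V G → Carrier
      p y = (f y - f x) * (Δ G f y - Δ G f x)
      ΔΓ : Δ G (Γ G f f) x ≈ ½ * ∑ (nbrs x) (λ y → D f y - D f x)
      ΔΓ = trans
        (∑-cong (nbrs x) λ y → trans (+-cong (Γ≈½D f y) (-‿cong (Γ≈½D f x)))
          (solve 3 (λ h a b → h :* a :- h :* b := h :* (a :- b)) refl ½ _ _))
        (∑-* (nbrs x) ½ _)

    -- The hypothesis concerns differences only, so that `g` may be `t` times `f` plus a constant;
    -- sections of f ⊕ g have this shape with t = 1.
    module _ {t : Carrier} {f g : Fun G} (g~tf : ∀ y z → g z - g y ≈ t * (f z - f y)) where
      Δ-scale : ∀ x → Δ G g x ≈ t * Δ G f x
      Δ-scale x = trans (∑-cong (nbrs x) (g~tf x)) (∑-* (nbrs x) t _)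

      D-scale : ∀ x → D g x ≈ t * t * D f x
      D-scale x = trans
        (∑-cong (nbrs x) λ y → trans (*-cong (g~tf x y) (g~tf x y))
          (solve 2 (λ t a → t :* a :* (t :* a) := t :* t :* (a :* a)) refl t _))
        (∑-* (nbrs x) (t * t) _)

      E-scale : ∀ x → E g x ≈ t * t * E f x
      E-scale x = trans (∑-cong (nbrs x) scaled) (∑-* (nbrs x) (t * t) _)
        where
        scaled : ∀ y → e g x y ≈ t * t * e f x y
        scaled y = trans
          (+-cong (+-cong (+-cong (D-scale y) (-‿cong (D-scale x))) (-‿cong p)) (-‿cong p))
          (solve 6 (λ t d d′ u a a′ →
              (t :* t :* d :- t :* t :* d′) :- t :* u :* (t :* a :- t :* a′)
                :- t :* u :* (t :* a :- t :* a′)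
              := t :* t :* ((d :- d′) :- u :* (a :- a′) :- u :* (a :- a′)))
            refl t (D f y) (D f x) (f y - f x) (Δ G f y) (Δ G f x))
          where
          p = *-cong (g~tf x y) (+-cong (Δ-scale y) (-‿cong (Δ-scale x)))

      Γ-scale : ∀ x → Γ G g g x ≈ t * t * Γ G f f x
      Γ-scale x = begin-equality
        Γ G g g x              ≈⟨ Γ≈½D g x ⟩
        ½ * D g x              ≈⟨ *-congˡ (D-scale x) ⟩
        ½ * (t * t * D f x)    ≈⟨
              solve 3 (λ h t a → h :* (t :* a) := t :* (h :* a)) refl ½ (t * t) _ ⟩
        t * t * (½ * D f x)    ≈⟨ *-congˡ (Γ≈½D f x) ⟨
        t * t * Γ G f f x      ∎

      Γ₂-scale : ∀ x → Γ₂ G g g x ≈ t * t * Γ₂ G f f x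
      Γ₂-scale x = begin-equality
        Γ₂ G g g x                   ≈⟨ Γ₂≈¼E g x ⟩
        ½ * (½ * E g x)              ≈⟨ *-congˡ (*-congˡ (E-scale x)) ⟩
        ½ * (½ * (t * t * E f x))    ≈⟨
              solve 3 (λ h t a → h :* (h :* (t :* a)) := t :* (h :* (h :* a))) refl ½ (t * t) _ ⟩
        t * t * (½ * (½ * E f x))    ≈⟨ *-congˡ (Γ₂≈¼E f x) ⟨
        t * t * Γ₂ G f f x           ∎

    D-nonNeg : ∀ f x → 0# ≤ D f x
    D-nonNeg f x = ∑-nonNeg (nbrs x) (λ _ → 0≤x² _)

    nbrCount : V G → Carrier
    nbrCount y = ∑ (nbrs y) (λ _ → 1#)

    -- This is ∑ (w - u)² ≥ 0 expanded, the form in which `e-lower` completes the square.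
    ∑-deviation : ∀ (xs : List (V G)) (w : V G → Carrier) u →
      0# ≤ ∑ xs (λ z → w z * w z) - u * ∑ xs w - u * ∑ xs w + u * u * ∑ xs (λ _ → 1#)
    ∑-deviation xs w u = ≤-trans (∑-nonNeg xs (λ {z} _ → 0≤x² (w z - u))) (≤-reflexive (expand xs))
      where
      expand : ∀ xs → ∑ xs (λ z → (w z - u) * (w z - u)) ≈
        ∑ xs (λ z → w z * w z) - u * ∑ xs w - u * ∑ xs w + u * u * ∑ xs (λ _ → 1#)
      expand [] = solve 1 (λ u → con (+ 0) := con (+ 0) :- u :* con (+ 0) :- u :* con (+ 0)
                    :+ u :* u :* con (+ 0)) refl u
      expand (z ∷ zs) = trans (+-congˡ (expand zs))
        (solve 5 (λ u w a b c →
            (w :- u) :* (w :- u) :+ (a :- u :* b :- u :* b :+ u :* u :* c)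
            := (w :* w :+ a) :- u :* (w :+ b) :- u :* (w :+ b) :+ u :* u :* (con (+ 1) :+ c))
          refl u (w z) _ _ _)

    edgeBound : V G → V G → Carrier
    edgeBound x y = nbrCount y + (1# + 1# + squareBound (nbrs x))

    -- Values of `f` at distance two enter only through D f y - 2u Δf(y), which is at least -u²
    -- times the number of neighbours of `y`. The rest is controlled by D f x: u² is one of its
    -- terms, 2ua ≥ -u² - a², and a² is bounded by `∑²≤∑-squares`.
    e-lower : ∀ f {x y} → y ∈ nbrs x → 0# ≤ e f x y + D f x * edgeBound x y
    e-lower f {x} {y} y∈ = ≤-trans
      (+-nonNeg (∑-deviation (nbrs y) (λ z → f z - f y) u)
        (+-nonNeg (*-nonNeg 0≤n 0≤D-u²) (+-nonNeg (0≤x² (u + a)) (+-nonNeg 0≤D-u²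
          (x≤y⇒0≤y-x (∑²≤∑-squares (nbrs x) (λ z → f z - f x)))))))
      (≤-reflexive (solve 7 (λ d t u n d′ a c →
          (d :- u :* t :- u :* t :+ u :* u :* n)
            :+ (n :* (d′ :- u :* u) :+ ((u :+ a) :* (u :+ a) :+ ((d′ :- u :* u) :+ (c :* d′ :- a :* a))))
          := (d :- d′) :- u :* (t :- a) :- u :* (t :- a)
               :+ d′ :* (n :+ (con (+ 1) :+ con (+ 1) :+ c)))
        refl (D f y) (Δ G f y) u (nbrCount y) (D f x) a (squareBound (nbrs x))))
      where
      u = f y - f x
      a = Δ G f x
      0≤n : 0# ≤ nbrCount y
      0≤n = ∑-nonNeg (nbrs y) (λ _ → 0≤1)
      0≤D-u² : 0# ≤ D f x - u * u
      0≤D-u² = x≤y⇒0≤y-x (term≤∑ (λ z → 0≤x² (f z - f x)) y∈)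

    edgeBounds : V G → Carrier
    edgeBounds x = ∑ (nbrs x) (edgeBound x)

    E-lower : ∀ f x → - edgeBounds x * D f x ≤ E f x
    E-lower f x = ≤-by (∑-nonNeg (nbrs x) (e-lower f)) (begin-equality
      E f x - - edgeBounds x * D f x
        ≈⟨ solve 3 (λ a b c → a :- (:- b) :* c := a :+ c :* b) refl _ (edgeBounds x) (D f x) ⟩
      E f x + D f x * edgeBounds x
        ≈⟨ +-congˡ (∑-* (nbrs x) (D f x) (edgeBound x)) ⟨
      E f x + ∑ (nbrs x) (λ y → D f x * edgeBound x y)
        ≈⟨ ∑-+ (nbrs x) (e f x) _ ⟨
      ∑ (nbrs x) (λ y → e f x y + D f x * edgeBound x y) ∎)

    -- The indicator function of the complement of `x`. Each neighbour of `x` adds 1 to its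
    -- Laplacian at `x`, so it serves as `f₀`.
    away : V G → Fun G
    away x z with em {z ≡ x}
    ... | yes _ = 0#
    ... | no  _ = 1#

    away-self : ∀ x → away x x ≈ 0#
    away-self x with em {x ≡ x}
    ... | yes _   = refl
    ... | no  x≢x = contradiction ≡.refl x≢x

    away-other : ∀ {x z} → ¬ (z ≡ x) → away x z ≈ 1#
    away-other {x} {z} z≢x with em {z ≡ x}
    ... | yes z≡x = contradiction z≡x z≢x
    ... | no  _   = refl

    0≤away : ∀ x z → 0# ≤ away x z
    0≤away x z with em {z ≡ x}
    ... | yes _ = ≤-refl
    ... | no  _ = 0≤1

    Δaway≉0 : ∀ {x} → 1 ℕ.≤ degree G x → ¬ (Δ G (away x) x ≈ 0#)
    Δaway≉0 {x} 1≤deg = pos⇒≉0 (<-≤-trans 0<1 (begin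
      1#                    ≈⟨ trans (solve 1 (λ o → o := o :- con (+ 0)) refl 1#)
                                 (+-cong (sym (away-other y≢x)) (-‿cong (sym (away-self x)))) ⟩
      away x y - away x x   ≤⟨ term≤∑ (λ z → x≤y⇒0≤y-x
            (≤-trans (≤-reflexive (away-self x)) (0≤away x z))) y∈ ⟩
      Δ G (away x) x        ∎))
      where
      member : ∀ (xs : List (V G)) → 1 ℕ.≤ length xs → ∃[ y ] (y ∈ xs)
      member (y ∷ _) _ = y , here ≡.refl
      y  = proj₁ (member (nbrs x) 1≤deg)
      y∈ = proj₂ (member (nbrs x) 1≤deg)
      y≢x : ¬ (y ≡ x)
      y≢x y≡x = Graph.∼-irrefl G (≡.subst (Graph._∼_ G x) y≡x (Equivalence.to (Graph.∈-nbrs G) y∈))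

    form : (x : V G) → 1 ℕ.≤ degree G x → Form
    form x 1≤deg = record
      { F      = Fun G
      ; α      = λ f → Δ G f x
      ; γ      = λ f → Γ G f f x
      ; γ₂     = λ f → Γ₂ G f f x
      -- `squareBound` compares (Δf)² with 2Γ, whence the factor 2 in `C`; `edgeBounds` compares 4Γ₂
      -- with 2Γ, whence the factor ½ in `K₀`.
      ; C      = c + c
      ; K₀     = ½ * - edgeBounds x
      ; 0≤C    = +-nonNeg 0≤c 0≤c
      ; 0≤γ    = λ f → ≤-trans (*-nonNeg 0≤½ (D-nonNeg f x)) (≤-reflexive (sym (Γ≈½D f x)))
      ; α²≤Cγ  = λ f → begin
          Δ G f x * Δ G f x        ≤⟨ ∑²≤∑-squares (nbrs x) (λ y → f y - f x) ⟩
          c * D f x                ≈⟨ *-congʳ (trans (sym (*-identityʳ c)) (*-congˡ (sym ½+½≈1))) ⟩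
          c * (½ + ½) * D f x      ≈⟨
                solve 3 (λ c h d → c :* (h :+ h) :* d := (c :+ c) :* (h :* d)) refl c ½ _ ⟩
          (c + c) * (½ * D f x)    ≈⟨ *-congˡ (Γ≈½D f x) ⟨
          (c + c) * Γ G f f x      ∎
      ; K₀γ≤γ₂ = λ f → begin
          ½ * - edgeBounds x * Γ G f f x      ≈⟨ *-congˡ (Γ≈½D f x) ⟩
          ½ * - edgeBounds x * (½ * D f x)    ≈⟨
                solve 3 (λ h k d → h :* k :* (h :* d) := h :* (h :* (k :* d))) refl ½ _ _ ⟩
          ½ * (½ * (- edgeBounds x * D f x))  ≤⟨ *-monoˡ-≤ 0≤½ (*-monoˡ-≤ 0≤½ (E-lower f x)) ⟩
          ½ * (½ * E f x)                     ≈⟨ Γ₂≈¼E f x ⟨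
          Γ₂ G f f x                          ∎
      ; scale  = λ t f →
          let g = λ z → t * f z
              g~tf : ∀ y z → g z - g y ≈ t * (f z - f y)
              g~tf y z = solve 3 (λ t a b → t :* a :- t :* b := t :* (a :- b)) refl t (f z) (f y)
          in g , Δ-scale g~tf x , Γ-scale g~tf x , Γ₂-scale g~tf x
      ; f₀     = away x
      ; αf₀≉0  = Δaway≉0 1≤deg
      }
      where
      c = squareBound (nbrs x)
      0≤c = squareBound-nonNeg (nbrs x)
      0≤½ = <⇒≤ (⁻¹-pos 0<2)

  -- Δ, Γ and Γ₂ on a Cartesian product.

  module Product (G₁ G₂ : Graph ℓ) where
    open Graph G₁ using () renaming (nbrs to nbrs₁)
    open Graph G₂ using () renaming (nbrs to nbrs₂)
    module L₁ = Local G₁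
    module L₂ = Local G₂
    module L  = Local (G₁ □ G₂)

    ∑-nbrs : ∀ x y (g : V (G₁ □ G₂) → Carrier) →
      ∑ (Graph.nbrs (G₁ □ G₂) (x , y)) g
        ≈ ∑ (nbrs₁ x) (λ x′ → g (x′ , y)) + ∑ (nbrs₂ y) (λ y′ → g (x , y′))
    ∑-nbrs x y g = begin-equality
      ∑ (map (x ,_) (nbrs₂ y) ++ map (_, y) (nbrs₁ x)) g
        ≈⟨ ∑-++ (map (x ,_) (nbrs₂ y)) _ g ⟩
      ∑ (map (x ,_) (nbrs₂ y)) g + ∑ (map (_, y) (nbrs₁ x)) g
        ≈⟨ +-cong (∑-map (x ,_) (nbrs₂ y) g) (∑-map (_, y) (nbrs₁ x) g) ⟩
      ∑ (nbrs₂ y) (λ y′ → g (x , y′)) + ∑ (nbrs₁ x) (λ x′ → g (x′ , y))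
        ≈⟨ +-comm _ _ ⟩
      ∑ (nbrs₁ x) (λ x′ → g (x′ , y)) + ∑ (nbrs₂ y) (λ y′ → g (x , y′)) ∎

    module _ (F : Fun (G₁ □ G₂)) where
      row : V G₂ → Fun G₁
      row y x = F (x , y)

      column : V G₁ → Fun G₂
      column x y = F (x , y)

      Δ-□ : ∀ x y → Δ (G₁ □ G₂) F (x , y) ≈ Δ G₁ (row y) x + Δ G₂ (column x) y
      Δ-□ x y = ∑-nbrs x y _

      D-□ : ∀ x y → L.D F (x , y) ≈ L₁.D (row y) x + L₂.D (column x) y
      D-□ x y = ∑-nbrs x y _

      mixed : (x x′ : V G₁) (y y′ : V G₂) → Carrier
      mixed x x′ y y′ = (F (x′ , y′) - F (x , y′)) - (F (x′ , y) - F (x , y))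

      -- b and c are the differences of F along one factor at the two ends of
      -- an edge in the other factor, on which F itself changes by u.
      crossTerm : (b c u : Carrier) → Carrier
      crossTerm b c u = (c * c - b * b) - u * (c - b) - u * (c - b)

      ∑-crossTerm : ∀ {A : Set ℓ} (xs : List A) b c u →
        (∑ xs (λ x → c x * c x) - ∑ xs (λ x → b x * b x)) - u * (∑ xs c - ∑ xs b) - u * (∑ xs c - ∑ xs b)
          ≈ ∑ xs (λ x → crossTerm (b x) (c x) u)
      ∑-crossTerm []       b c u =
        solve 1 (λ u → (con (+ 0) :- con (+ 0)) :- u :* (con (+ 0) :- con (+ 0))
                         :- u :* (con (+ 0) :- con (+ 0)) := con (+ 0)) refl u
      ∑-crossTerm (x ∷ xs) b c u = trans
        (solve 7 (λ u b c B C S T →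
            ((c :* c :+ C) :- (b :* b :+ B)) :- u :* ((c :+ T) :- (b :+ S)) :- u :* ((c :+ T) :- (b :+ S))
            := ((c :* c :- b :* b) :- u :* (c :- b) :- u :* (c :- b))
                 :+ ((C :- B) :- u :* (T :- S) :- u :* (T :- S)))
          refl u (b x) (c x) _ _ _ _)
        (+-congˡ (∑-crossTerm xs b c u))

      e-combine : ∀ d d′ t t′ u r r′ s s′ →
        ((d′ + r′) - (d + r)) - u * ((t′ + s′) - (t + s)) - u * ((t′ + s′) - (t + s))
          ≈ ((d′ - d) - u * (t′ - t) - u * (t′ - t)) + ((r′ - r) - u * (s′ - s) - u * (s′ - s))
      e-combine = solve 9 (λ d d′ t t′ u r r′ s s′ →
        ((d′ :+ r′) :- (d :+ r)) :- u :* ((t′ :+ s′) :- (t :+ s)) :- u :* ((t′ :+ s′) :- (t :+ s))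
          := ((d′ :- d) :- u :* (t′ :- t) :- u :* (t′ :- t))
               :+ ((r′ :- r) :- u :* (s′ :- s) :- u :* (s′ :- s))) refl

      e-cong : ∀ {d d₁ d′ d₁′ t t₁ t′ t₁′} u → d ≈ d₁ → d′ ≈ d₁′ → t ≈ t₁ → t′ ≈ t₁′ →
        (d′ - d) - u * (t′ - t) - u * (t′ - t) ≈ (d₁′ - d₁) - u * (t₁′ - t₁) - u * (t₁′ - t₁)
      e-cong u d≈ d′≈ t≈ t′≈ = +-cong (+-cong (+-cong d′≈ (-‿cong d≈)) (-‿cong ut)) (-‿cong ut)
        where ut = *-congˡ (+-cong t′≈ (-‿cong t≈))

      -- Along an edge of the first factor, the row parts of `D` and Δ reproduce the edge term of
      -- G₁. The column parts change as well, and `∑-crossTerm` gathers their change neighbour by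
      -- neighbour in G₂.
      e-horizontal : ∀ x y x′ → L.e F (x , y) (x′ , y) ≈ L₁.e (row y) x x′
        + ∑ (nbrs₂ y) (λ y′ → crossTerm (F (x , y′) - F (x , y)) (F (x′ , y′) - F (x′ , y))
                                        (F (x′ , y) - F (x , y)))
      e-horizontal x y x′ = trans
        (e-cong (F (x′ , y) - F (x , y)) (D-□ x y) (D-□ x′ y) (Δ-□ x y) (Δ-□ x′ y))
        (trans (e-combine _ _ _ _ _ _ _ _ _) (+-congˡ (∑-crossTerm (nbrs₂ y) _ _ _)))

      e-vertical : ∀ x y y′ → L.e F (x , y) (x , y′) ≈ L₂.e (column x) y y′
        + ∑ (nbrs₁ x) (λ x′ → crossTerm (F (x′ , y) - F (x , y)) (F (x′ , y′) - F (x , y′))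
                                        (F (x , y′) - F (x , y)))
      e-vertical x y y′ = trans
        (e-cong (F (x , y′) - F (x , y))
          (trans (D-□ x y) (+-comm _ _)) (trans (D-□ x y′) (+-comm _ _))
          (trans (Δ-□ x y) (+-comm _ _)) (trans (Δ-□ x y′) (+-comm _ _)))
        (trans (e-combine _ _ _ _ _ _ _ _ _) (+-congˡ (∑-crossTerm (nbrs₁ x) _ _ _)))

      crossSum : V G₁ → V G₂ → Carrier
      crossSum x y = ∑ (nbrs₁ x) λ x′ → ∑ (nbrs₂ y) λ y′ →
        mixed x x′ y y′ * mixed x x′ y y′ + mixed x x′ y y′ * mixed x x′ y y′

      -- Each pair of neighbours x′, y′ spans a square with one cross term from its horizontal edge
      -- and one from its vertical edge at (x , y). Neither need have a sign, but together they are
      -- twice the square of the mixed difference; `∑-swap` pairs them up.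
      E-□ : ∀ x y → L.E F (x , y) ≈ L₁.E (row y) x + L₂.E (column x) y + crossSum x y
      E-□ x y = begin-equality
        L.E F (x , y)
          ≈⟨ ∑-nbrs x y _ ⟩
        ∑ (nbrs₁ x) (λ x′ → L.e F (x , y) (x′ , y)) + ∑ (nbrs₂ y) (λ y′ → L.e F (x , y) (x , y′))
          ≈⟨ +-cong
               (trans (∑-cong (nbrs₁ x) (e-horizontal x y)) (∑-+ (nbrs₁ x) _ _))
               (trans (∑-cong (nbrs₂ y) (e-vertical x y)) (∑-+ (nbrs₂ y) _ _)) ⟩
        (L₁.E (row y) x + H) + (L₂.E (column x) y + ∑ (nbrs₂ y) (λ y′ → ∑ (nbrs₁ x) (λ x′ → v x′ y′)))
          ≈⟨ +-congˡ (+-congˡ (∑-swap (nbrs₁ x) (nbrs₂ y) v)) ⟨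
        (L₁.E (row y) x + H) + (L₂.E (column x) y + W)
          ≈⟨ solve 4 (λ a h b w → (a :+ h) :+ (b :+ w) := a :+ b :+ (h :+ w)) refl _ H _ W ⟩
        L₁.E (row y) x + L₂.E (column x) y + (H + W)
          ≈⟨ +-congˡ (trans (sym (∑-+ (nbrs₁ x) _ _)) (∑-cong (nbrs₁ x) λ x′ →
               trans (sym (∑-+ (nbrs₂ y) _ _)) (∑-cong (nbrs₂ y) (square x′)))) ⟩
        L₁.E (row y) x + L₂.E (column x) y + crossSum x y ∎
        where
        h v : V G₁ → V G₂ → Carrier
        h x′ y′ = crossTerm (F (x , y′) - F (x , y)) (F (x′ , y′) - F (x′ , y)) (F (x′ , y) - F (x , y))
        v x′ y′ = crossTerm (F (x′ , y) - F (x , y)) (F (x′ , y′) - F (x , y′)) (F (x , y′) - F (x , y))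
        H = ∑ (nbrs₁ x) (λ x′ → ∑ (nbrs₂ y) (h x′))
        W = ∑ (nbrs₁ x) (λ x′ → ∑ (nbrs₂ y) (v x′))
        square : ∀ x′ y′ → h x′ y′ + v x′ y′ ≈
          mixed x x′ y y′ * mixed x x′ y y′ + mixed x x′ y y′ * mixed x x′ y y′
        square x′ y′ = solve 4 (λ F₀₀ F₁₀ F₀₁ F₁₁ →
            (((F₁₁ :- F₁₀) :* (F₁₁ :- F₁₀) :- (F₀₁ :- F₀₀) :* (F₀₁ :- F₀₀))
              :- (F₁₀ :- F₀₀) :* ((F₁₁ :- F₁₀) :- (F₀₁ :- F₀₀))
              :- (F₁₀ :- F₀₀) :* ((F₁₁ :- F₁₀) :- (F₀₁ :- F₀₀)))
            :+ (((F₁₁ :- F₀₁) :* (F₁₁ :- F₀₁) :- (F₁₀ :- F₀₀) :* (F₁₀ :- F₀₀))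
              :- (F₀₁ :- F₀₀) :* ((F₁₁ :- F₀₁) :- (F₁₀ :- F₀₀))
              :- (F₀₁ :- F₀₀) :* ((F₁₁ :- F₀₁) :- (F₁₀ :- F₀₀)))
            := ((F₁₁ :- F₀₁) :- (F₁₀ :- F₀₀)) :* ((F₁₁ :- F₀₁) :- (F₁₀ :- F₀₀))
              :+ ((F₁₁ :- F₀₁) :- (F₁₀ :- F₀₀)) :* ((F₁₁ :- F₀₁) :- (F₁₀ :- F₀₀)))
          refl (F (x , y)) (F (x′ , y)) (F (x , y′)) (F (x′ , y′))

      Γ-□ : ∀ x y → Γ (G₁ □ G₂) F F (x , y) ≈ Γ G₁ (row y) (row y) x + Γ G₂ (column x) (column x) y
      Γ-□ x y = begin-equality
        Γ (G₁ □ G₂) F F (x , y)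
          ≈⟨ L.Γ≈½D F (x , y) ⟩
        ½ * L.D F (x , y)
          ≈⟨ *-congˡ (D-□ x y) ⟩
        ½ * (L₁.D (row y) x + L₂.D (column x) y)
          ≈⟨ distribˡ ½ _ _ ⟩
        ½ * L₁.D (row y) x + ½ * L₂.D (column x) y
          ≈⟨ +-cong (L₁.Γ≈½D (row y) x) (L₂.Γ≈½D (column x) y) ⟨
        Γ G₁ (row y) (row y) x + Γ G₂ (column x) (column x) y ∎

      Γ₂-□ : ∀ x y → Γ₂ (G₁ □ G₂) F F (x , y) ≈
        Γ₂ G₁ (row y) (row y) x + Γ₂ G₂ (column x) (column x) y + ½ * (½ * crossSum x y)
      Γ₂-□ x y = begin-equality
        Γ₂ (G₁ □ G₂) F F (x , y)
          ≈⟨ L.Γ₂≈¼E F (x , y) ⟩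
        ½ * (½ * L.E F (x , y))
          ≈⟨ *-congˡ (*-congˡ (E-□ x y)) ⟩
        ½ * (½ * (L₁.E (row y) x + L₂.E (column x) y + crossSum x y))
          ≈⟨ solve 4 (λ h a b c →
                 h :* (h :* (a :+ b :+ c)) := h :* (h :* a) :+ h :* (h :* b) :+ h :* (h :* c))
               refl ½ _ _ _ ⟩
        ½ * (½ * L₁.E (row y) x) + ½ * (½ * L₂.E (column x) y) + ½ * (½ * crossSum x y)
          ≈⟨ +-congʳ (+-cong (L₁.Γ₂≈¼E (row y) x) (L₂.Γ₂≈¼E (column x) y)) ⟨
        Γ₂ G₁ (row y) (row y) x + Γ₂ G₂ (column x) (column x) y + ½ * (½ * crossSum x y) ∎

      crossSum-nonNeg : ∀ x y → 0# ≤ crossSum x y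
      crossSum-nonNeg x y = ∑-nonNeg (nbrs₁ x) λ _ → ∑-nonNeg (nbrs₂ y) λ _ →
        +-nonNeg (0≤x² _) (0≤x² _)

      crossSum-zero : ∀ {x y} → (∀ x′ y′ → mixed x x′ y y′ ≈ 0#) → crossSum x y ≈ 0#
      crossSum-zero {x} {y} mixed≈0 = trans
        (∑-cong (nbrs₁ x) λ x′ → trans
          (∑-cong (nbrs₂ y) λ y′ → trans
            (+-cong (*-congʳ (mixed≈0 x′ y′)) (*-congʳ (mixed≈0 x′ y′)))
            (solve 1 (λ m → con (+ 0) :* m :+ con (+ 0) :* m := con (+ 0)) refl _))
          (∑-0 (nbrs₂ y)))
        (∑-0 (nbrs₁ x))

    _⊕_ : Fun G₁ → Fun G₂ → Fun (G₁ □ G₂)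
    (f ⊕ g) (x , y) = f x + g y

    module _ (f : Fun G₁) (g : Fun G₂) where
      mixed-⊕ : ∀ x x′ y y′ → mixed (f ⊕ g) x x′ y y′ ≈ 0#
      mixed-⊕ x x′ y y′ = solve 4 (λ a a′ b b′ →
        ((a′ :+ b′) :- (a :+ b′)) :- ((a′ :+ b) :- (a :+ b)) := con (+ 0))
              refl (f x) (f x′) (g y) (g y′)

      row-⊕ : ∀ y x x′ → row (f ⊕ g) y x′ - row (f ⊕ g) y x ≈ 1# * (f x′ - f x)
      row-⊕ y x x′ = solve 3 (λ a a′ b → (a′ :+ b) :- (a :+ b) := con (+ 1) :* (a′ :- a))
            refl (f x) (f x′) (g y)

      column-⊕ : ∀ x y y′ → column (f ⊕ g) x y′ - column (f ⊕ g) x y ≈ 1# * (g y′ - g y)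
      column-⊕ x y y′ = solve 3 (λ a b b′ → (a :+ b′) :- (a :+ b) := con (+ 1) :* (b′ :- b))
            refl (f x) (g y) (g y′)

    1*1* : ∀ a → 1# * 1# * a ≈ a
    1*1* = solve 1 (λ a → con (+ 1) :* con (+ 1) :* a := a) refl

    -- `split` takes the sections through (x , y) and discards the nonnegative `crossSum`. `join` is
    -- exact because `crossSum` vanishes on f ⊕ g, whose sections differ from `f` and `g` by
    -- constants.
    isSum : ∀ x y (dx : 1 ℕ.≤ degree G₁ x) (dy : 1 ℕ.≤ degree G₂ y) dxy →
      IsSum (L.form (x , y) dxy) (L₁.form x dx) (L₂.form y dy)
    isSum x y dx dy dxy = record
      { split = λ F → row F y , column F x , Δ-□ F x y , Γ-□ F x y ,
          ≤-by (*-nonNeg 0≤½ (*-nonNeg 0≤½ (crossSum-nonNeg F x y)))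
            (trans (+-congʳ (Γ₂-□ F x y)) (solve 2 (λ a c → a :+ c :- a := c) refl _ _))
      ; join  = λ f g → f ⊕ g ,
          trans (Δ-□ (f ⊕ g) x y)
            (+-cong (trans (L₁.Δ-scale (row-⊕ f g y) x) (*-identityˡ _))
                    (trans (L₂.Δ-scale (column-⊕ f g x) y) (*-identityˡ _))) ,
          trans (Γ-□ (f ⊕ g) x y)
            (+-cong (trans (L₁.Γ-scale (row-⊕ f g y) x) (1*1* _))
                    (trans (L₂.Γ-scale (column-⊕ f g x) y) (1*1* _))) ,
          (begin-equality
            Γ₂ (G₁ □ G₂) (f ⊕ g) (f ⊕ g) (x , y)
              ≈⟨ Γ₂-□ (f ⊕ g) x y ⟩
            Γ₂ G₁ (row (f ⊕ g) y) (row (f ⊕ g) y) x + Γ₂ G₂ (column (f ⊕ g) x) (column (f ⊕ g) x) y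
              + ½ * (½ * crossSum (f ⊕ g) x y)
              ≈⟨ +-cong (+-cong (trans (L₁.Γ₂-scale (row-⊕ f g y) x) (1*1* _))
                                (trans (L₂.Γ₂-scale (column-⊕ f g x) y) (1*1* _)))
                   (trans (*-congˡ (trans (*-congˡ (crossSum-zero (f ⊕ g) λ x′ y′ → mixed-⊕ f g x x′ y y′))
                            (zeroʳ ½)))
                          (zeroʳ ½)) ⟩
            Γ₂ G₁ f f x + Γ₂ G₂ g g y + 0#
              ≈⟨ +-identityʳ _ ⟩
            Γ₂ G₁ f f x + Γ₂ G₂ g g y ∎)
      }
      where
      0≤½ = <⇒≤ (⁻¹-pos 0<2)

-- The curvature function of a Cartesian product.

open import Data.Nat.Base using (_≤_)

□-degree : ∀ {ℓ} (G₁ G₂ : Graph ℓ) x y → 1 ≤ degree G₂ y → 1 ≤ degree (G₁ □ G₂) (x , y)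
□-degree G₁ G₂ x y 1≤deg with Graph.nbrs G₂ y
... | _ ∷ _ = s≤s z≤n

theorem7p9 : ∀ {ℓ : Level} (em : ExcludedMiddle ℓ) (ℝ : RealField ℓ) →
    let open RealField ℝ using (_≈_)
        open Curvature em ℝ
    in (G₁ G₂ : Graph ℓ) (x : V G₁) (y : V G₂) →
       1 ≤ degree G₁ x → 1 ≤ degree G₂ y →
       ∀ (N : ]0,∞]) → 𝒦 (G₁ □ G₂) (x , y) N ≈ (𝒦 G₁ x ⋆ 𝒦 G₂ y) N
-- `𝒦 G x` unfolds to `𝒦-of` of the form of `G` at `x`, so the abstract statement about sums applies
-- as it stands.
theorem7p9 em ℝ G₁ G₂ x y dx dy = κ-sum _ _ _ (isSum x y dx dy (□-degree G₁ G₂ x y dy))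
  where
  open CurvatureForms em ℝ
  open GraphForms em ℝ
  open Product G₁ G₂
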